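{- For every positive integer $n$, the statistics $(\mathrm{des}, Id, \mathrm{F}, \mathrm{MAJ}, \mathrm{STAT})$ and $(\mathrm{des}, Id, \mathrm{F}, \mathrm{STAT}, \mathrm{MAJ})$ have the same joint distribution on $\mathcal{S}_n$. That is, for every tuple $(d,S,f,a,b)$, the number of $\pi\in\mathcal{S}_n$ with $(\mathrm{des}\,\pi, Id(\pi), \mathrm{F}\,\pi, \mathrm{MAJ}\,\pi, \mathrm{STAT}\,\pi)=(d,S,f,a,b)$ equals the number of $\pi\in\mathcal{S}_n$ with $(\mathrm{des}\,\pi, Id(\pi), \mathrm{F}\,\pi, \mathrm{STAT}\,\pi, \mathrm{MAJ}\,\pi)=(d,S,f,a,b)$.
   Context: $\mathcal{S}_n$ is the set of permutations $\pi=\pi_1\cdots\pi_n$ of $\{1,\dots,n\}$ in one-line notation. Define: the descent set $D(\pi)=\{i: 1\le i<n,\ \pi_i>\pi_{i+1}\}$; $\mathrm{des}\,\pi=|D(\pi)|$; $\mathrm{MAJ}\,\pi=\sum_{i\in D(\pi)} i$; $\mathrm{F}\,\pi=\pi_1$; the inverse descent set $Id(\pi)=\{k: 1\le k<n,\ k+1 \text{ appears to the left of } k \text{ in } \pi\}$; and $\mathrm{STAT}\,\pi = \mathrm{des}\,\pi + \#\{(i,j): 1\le i,\ i+1<j\le n,\ \pi_{i+1}<\pi_i<\pi_j\} + \#\{(i,j): i+1<j,\ \pi_i<\pi_j<\pi_{i+1}\} + \#\{(i,j): i+1<j,\ \pi_j<\pi_{i+1}<\pi_i\}$ (i.e. the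 sum of the numbers of occurrences of the vincular patterns $\underline{21}$, $\underline{21}3$, $\underline{13}2$, $\underline{32}1$, where underlined letters must be adjacent in $\pi$). -}

module Defs where

open import Data.Nat using (ℕ; zero; suc; _+_; _<_; _<ᵇ_; _≡ᵇ_; _≟_; _<?_)
open import Data.Bool using (Bool; true; false; if_then_else_; _∧_; _∨_)
open import Data.Fin using (Fin; toℕ)
open import Data.Vec using (Vec; []; _∷_; toList)
open import Data.List as L using (List; []; _∷_; length; filter; map; concatMap; upTo)
open import Data.List.Relation.Unary.Unique.Propositional using (Unique)
open import Data.List.Relation.Unary.Unique.DecPropositional using (unique?)
import Data.Fin.Properties as FinP
open import Data.Product using (_×_)
open import Relation.Binary.PropositionalEquality using (_≡_)
open import Relation.Nullary.Decidable using (_×-dec_)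
import Data.List.Properties as LP

-- A permutation word over an alphabet of naturals is modelled as a List ℕ;
-- π = π₁ ⋯ πₙ with positions counted from 1.

allVecs : (n k : ℕ) → List (Vec (Fin n) k)
allVecs n zero    = [] ∷ []
allVecs n (suc k) = concatMap (λ i → map (i ∷_) (allVecs n k)) (L.allFin n)

-- 𝒮ₙ in one-line notation: all injective words Fin n → Fin n, with the entry
-- i ∈ Fin n read as the value toℕ i + 1 ∈ {1,…,n}.
Sn : ℕ → List (List ℕ)
Sn n = map (λ v → map (λ i → suc (toℕ i)) (toList v))
           (filter (λ v → unique? FinP._≟_ (toList v)) (allVecs n n))

b2n : Bool → ℕ
b2n true  = 1
b2n false = 0

des : List ℕ → ℕ
des (a ∷ b ∷ r) = b2n (b <ᵇ a) + des (b ∷ r)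
des _           = 0

majFrom : ℕ → List ℕ → ℕ
majFrom i (a ∷ b ∷ r) = (if b <ᵇ a then i else 0) + majFrom (suc i) (b ∷ r)
majFrom i _           = 0

MAJ : List ℕ → ℕ
MAJ = majFrom 1

F : List ℕ → ℕ
F []      = 0
F (a ∷ _) = a

pos : ℕ → List ℕ → ℕ
pos x []      = 0
pos x (a ∷ w) = if x ≡ᵇ a then 1 else suc (pos x w)

Id : List ℕ → List ℕ
Id w = filter (λ k → pos (suc k) w <? pos k w)
              (map suc (upTo (length w ∸1)))
  where
    _∸1 : ℕ → ℕ
    zero ∸1  = zero
    suc m ∸1 = m

countB : (ℕ → Bool) → List ℕ → ℕ
countB p []      = 0
countB p (c ∷ r) = b2n (p c) + countB p r

-- STAT π = #21 + #(21)3 + #(13)2 + #(32)1 (vincular patterns; the underlined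
-- pair is the adjacent pair (πᵢ, πᵢ₊₁) = (a, b), the third letter c = πⱼ, j > i+1)
STAT : List ℕ → ℕ
STAT (a ∷ b ∷ r) =
  b2n (b <ᵇ a)
  + countB (λ c → (b <ᵇ a) ∧ (a <ᵇ c)) r
  + countB (λ c → (a <ᵇ c) ∧ (c <ᵇ b)) r
  + countB (λ c → (c <ᵇ b) ∧ (b <ᵇ a)) r
  + STAT (b ∷ r)
STAT _ = 0

countJoint : (X Y : List ℕ → ℕ) → ℕ → ℕ → List ℕ → ℕ → ℕ → ℕ → ℕ
countJoint X Y n d S f a b =
  length (filter (λ π → (des π ≟ d) ×-dec (LP.≡-dec _≟_ (Id π) S)
                        ×-dec (F π ≟ f) ×-dec (X π ≟ a) ×-dec (Y π ≟ b))
                 (Sn n))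

{-# OPTIONS --safe #-}
module Submission where

-- Placing the letters on a circle shows MAJ + STAT + F = (n + 1) des + 1 on 𝒮ₙ, so the
-- claim is that MAJ is symmetrically distributed once des, Id and F are fixed.  Count
-- functions b from the letters to {0, …, s} with b f = s, b x < s for x < f and b x ≤ s
-- for x > f.  Sorting the letters by decreasing b, ties by increasing letter, gives a
-- permutation π with F π = f and Id π = {k : b k < b (k + 1)}.
--  * For a fixed π, the b sorted by π are the partitions in an (n − 1) × (s − des π) box,
--    shifted by MAJ π; their sizes are symmetrically distributed.
--  * The b with a prescribed set of rises are symmetrically distributed as well: by
--    inclusion–exclusion this reduces to weakly decreasing runs, which are partitions
--    in a box again.
-- In the sum over π for a given s only des π ≤ s occurs, and des π = s contributes the
-- single weight MAJ π, so the symmetry for des π = s follows by induction on s.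
-- Every symmetry is stated for two weights exchanging places, here MAJ − des and
-- STAT − des, so that no subtraction is needed.

open import Defs
open import Data.Bool using (Bool; true; false; _∧_; if_then_else_; T)
open import Data.Nat
open import Data.Nat.Properties
open import Data.Nat.ListAction using (sum)
open import Data.Nat.Tactic.RingSolver using (solve-∀)
open import Algebra.Properties.CommutativeSemigroup +-commutativeSemigroup using (interchange; x∙yz≈y∙xz)
open import Data.Fin as Fin using (Fin; toℕ; fromℕ<)
open import Data.Fin.Properties using (toℕ-injective; toℕ<n; toℕ-fromℕ<)
open import Data.Vec using (Vec; []; _∷_; toList)
open import Data.Vec.Properties using (length-toList; ∷-injective)
open import Data.List using (List; []; _∷_; map; length; filter; replicate; upTo; applyUpTo; downFrom; concatMap; allFin; cartesianProductWith; _++_)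
open import Data.List.Properties as List using (length-map; map-injective; map-++; map-cong-local; ≡-dec)
open import Data.List.Membership.Propositional using (_∈_; _∉_)
open import Data.List.Membership.Propositional.Properties
open import Data.List.Membership.DecPropositional _≟_ using (_∈?_)
open import Data.List.Relation.Unary.Any as Any using (here; there)
open import Data.List.Relation.Unary.All as All using (All; []; _∷_)
import Data.List.Relation.Unary.All.Properties as All
open import Data.List.Relation.Unary.AllPairs using (AllPairs; []; _∷_)
open import Data.List.Relation.Unary.Linked as Linked using (Linked; linked?)
open import Data.List.Relation.Unary.Linked.Properties using (Linked⇒AllPairs; AllPairs⇒Linked)
open import Data.List.Relation.Unary.Unique.Propositional using (Unique)
import Data.List.Relation.Unary.Unique.Propositional.Properties as Unique
open import Data.List.Relation.Unary.Unique.DecPropositional using (unique?)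
open import Data.List.Relation.Binary.Subset.Propositional using (_⊆_)
open import Data.List.Relation.Binary.Permutation.Propositional using (_↭_; refl; prep; swap; ↭-sym) renaming (trans to ↭-trans)
open import Data.List.Relation.Binary.Permutation.Propositional.Properties using (∈-resp-↭; All-resp-↭; drop-∷; shift; ↭-length; ↭-empty-inv; ¬x∷xs↭[])
open import Data.Product using (_×_; _,_; proj₁; proj₂; ∃)
open import Data.Sum using (_⊎_; inj₁; inj₂)
open import Function using (_∘_; flip; id; mk⇔)
open import Relation.Binary.Definitions using (tri<; tri≈; tri>)
open import Relation.Binary.PropositionalEquality
open import Relation.Nullary using (¬_; Dec; yes; no; does; contradiction)
open import Relation.Nullary.Decidable using (does-⇔; dec-true; dec-false; _×-dec_; _⊎-dec_)
open import Relation.Unary using (Decidable)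

-- Finite sums

∑ : {A : Set} → List A → (A → ℕ) → ℕ
∑ []       g = 0
∑ (x ∷ xs) g = g x + ∑ xs g

∑< : ℕ → (ℕ → ℕ) → ℕ
∑< n = ∑ (downFrom n)

module _ {A : Set} where

  ∑-cong : ∀ {g g′ : A → ℕ} xs → (∀ x → x ∈ xs → g x ≡ g′ x) → ∑ xs g ≡ ∑ xs g′
  ∑-cong []       e = refl
  ∑-cong (x ∷ xs) e = cong₂ _+_ (e x (here refl)) (∑-cong xs (λ y → e y ∘ there))

  ∑-zero : ∀ {g : A → ℕ} xs → (∀ x → x ∈ xs → g x ≡ 0) → ∑ xs g ≡ 0
  ∑-zero []       e = refl
  ∑-zero (x ∷ xs) e = cong₂ _+_ (e x (here refl)) (∑-zero xs (λ y → e y ∘ there))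

  ∑-+ : ∀ {g g′ : A → ℕ} xs → ∑ xs (λ x → g x + g′ x) ≡ ∑ xs g + ∑ xs g′
  ∑-+ []               = refl
  ∑-+ {g} {g′} (x ∷ xs) = trans (cong (g x + g′ x +_) (∑-+ xs)) (interchange (g x) (g′ x) _ _)

  ∑-*ʳ : ∀ {g : A → ℕ} c xs → ∑ xs (λ x → g x * c) ≡ ∑ xs g * c
  ∑-*ʳ c []           = refl
  ∑-*ʳ {g} c (x ∷ xs) = trans (cong (g x * c +_) (∑-*ʳ c xs)) (sym (*-distribʳ-+ c (g x) _))

∑-swap : ∀ {A B : Set} {g : A → B → ℕ} xs ys →
         ∑ xs (λ x → ∑ ys (g x)) ≡ ∑ ys (λ y → ∑ xs (λ x → g x y))
∑-swap []           ys = sym (∑-zero ys (λ _ _ → refl))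
∑-swap {g = g} (x ∷ xs) ys = trans (cong (∑ ys (g x) +_) (∑-swap xs ys)) (sym (∑-+ ys))

∑<-cong : ∀ {g g′} n → (∀ i → i < n → g i ≡ g′ i) → ∑< n g ≡ ∑< n g′
∑<-cong n e = ∑-cong (downFrom n) (λ i → e i ∘ ∈-downFrom⁻)

-- Partitions in a box and weakly decreasing runs

-- The weakly decreasing words c of length m with letters below N, in the weights
-- Σ cᵢ and Σ (N − 1 − cᵢ); the recursion splits on whether c₁ = N − 1.
boxSum : ℕ → ℕ → (ℕ → ℕ → ℕ) → ℕ
boxSum zero    N       φ = φ 0 0
boxSum (suc m) zero    φ = 0
boxSum (suc m) (suc N) φ =
  boxSum m (suc N) (λ u v → φ (N + u) v) + boxSum (suc m) N (λ u v → φ u (suc m + v))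

-- Every letter satisfies c + (N - 1 - c) + 1 = N, so only pairs with `u + v + m ≡ m * N` occur.
-- This ties the second weight to the first without subtraction.
boxSum-cong : ∀ {φ φ′} m N → (∀ u v → u + v + m ≡ m * N → φ u v ≡ φ′ u v) →
              boxSum m N φ ≡ boxSum m N φ′
boxSum-cong zero    N       e = e 0 0 refl
boxSum-cong (suc m) zero    e = refl
boxSum-cong (suc m) (suc N) e = cong₂ _+_
  (boxSum-cong m (suc N) (λ u v p → e (N + u) v (trans (lemma₁ m N u v) (cong (suc N +_) p))))
  (boxSum-cong (suc m) N (λ u v p → e u (suc m + v) (trans (lemma₂ m N u v) (trans (cong (suc m +_) p) (sym (*-suc (suc m) N))))))
  where
  lemma₁ : ∀ m N u v → N + u + v + suc m ≡ suc N + (u + v + m)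
  lemma₁ = solve-∀
  lemma₂ : ∀ m N u v → u + (suc m + v) + suc m ≡ suc m + (u + v + suc m)
  lemma₂ = solve-∀

boxSum-ext : ∀ {φ φ′} m N → (∀ u v → φ u v ≡ φ′ u v) → boxSum m N φ ≡ boxSum m N φ′
boxSum-ext m N e = boxSum-cong m N (λ u v _ → e u v)

boxSum-empty : ∀ m φ → 1 ≤ m → boxSum m 0 φ ≡ 0
boxSum-empty (suc m) φ _ = refl

boxSum-one : ∀ m φ → boxSum m 1 φ ≡ φ 0 0
boxSum-one zero    φ = refl
boxSum-one (suc m) φ = trans (+-identityʳ _) (boxSum-one m φ)

-- The same words split on whether the last letter is 0.
boxSum-last : ∀ m N φ → boxSum (suc m) (suc N) φ ≡
  boxSum m (suc N) (λ u v → φ u (N + v)) + boxSum (suc m) N (λ u v → φ (suc m + u) v)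
boxSum-last zero    zero    φ = refl
boxSum-last (suc m) zero    φ = cong (_+ 0) (trans (boxSum-one (suc m) _) (sym (boxSum-one (suc m) _)))
boxSum-last zero    (suc N) φ = begin
  φ (suc N + 0) 0 + boxSum 1 (suc N) (λ u v → φ u (suc v))
    ≡⟨ cong₂ _+_ (cong (λ z → φ z 0) (+-identityʳ (suc N))) (boxSum-last 0 N (λ u v → φ u (suc v))) ⟩
  φ (suc N) 0 + (φ 0 (suc N + 0) + boxSum 1 N (λ u v → φ (suc u) (suc v)))
    ≡⟨ x∙yz≈y∙xz (φ (suc N) 0) (φ 0 (suc N + 0)) _ ⟩
  φ 0 (suc N + 0) + (φ (suc N) 0 + boxSum 1 N (λ u v → φ (suc u) (suc v)))
    ≡⟨ cong (λ z → φ 0 (suc N + 0) + (φ z 0 + boxSum 1 N (λ u v → φ (suc u) (suc v)))) (sym (+-identityʳ (suc N))) ⟩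
  φ 0 (suc N + 0) + boxSum 1 (suc N) (λ u v → φ (suc u) v) ∎
  where
  open ≡-Reasoning
boxSum-last (suc m) (suc N) φ = begin
  boxSum (suc m) (2 + N) (λ u v → φ (suc N + u) v) + boxSum (2 + m) (suc N) (λ u v → φ u (2 + m + v))
    -- Four cases arise, by first and last letter; grouped by the last letter, each pair is the
    -- first-letter recursion of one target term.
    ≡⟨ cong₂ _+_ (boxSum-last m (suc N) (λ u v → φ (suc N + u) v)) (boxSum-last (suc m) N (λ u v → φ u (2 + m + v))) ⟩
  (boxSum m (2 + N) (λ u v → φ (suc N + u) (suc N + v)) + boxSum (suc m) (suc N) (λ u v → φ (suc N + (suc m + u)) v))
  + (boxSum (suc m) (suc N) (λ u v → φ u (2 + m + (N + v))) + boxSum (2 + m) N (λ u v → φ (2 + m + u) (2 + m + v)))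
    ≡⟨ interchange (boxSum m (2 + N) (λ u v → φ (suc N + u) (suc N + v))) _ _ _ ⟩
  (boxSum m (2 + N) (λ u v → φ (suc N + u) (suc N + v)) + boxSum (suc m) (suc N) (λ u v → φ u (2 + m + (N + v))))
  + (boxSum (suc m) (suc N) (λ u v → φ (suc N + (suc m + u)) v) + boxSum (2 + m) N (λ u v → φ (2 + m + u) (2 + m + v)))
    ≡⟨ cong₂ (λ x y → (boxSum m (2 + N) (λ u v → φ (suc N + u) (suc N + v)) + x) + (y + boxSum (2 + m) N (λ u v → φ (2 + m + u) (2 + m + v))))
        (boxSum-ext (suc m) (suc N) (λ u v → cong (φ u) (exchange m N v)))
        (boxSum-ext (suc m) (suc N) (λ u v → cong (λ z → φ z v) (sym (exchange m N u)))) ⟩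
  boxSum (suc m) (2 + N) (λ u v → φ u (suc N + v)) + boxSum (2 + m) (suc N) (λ u v → φ (2 + m + u) v) ∎
  where
  open ≡-Reasoning
  exchange : ∀ m N v → 2 + m + (N + v) ≡ suc N + (suc m + v)
  exchange = solve-∀

-- Complementing the letters and reversing the word exchanges the weights; accordingly, the
-- first-letter split for φ becomes the last-letter split for `flip φ`.
boxSum-sym : ∀ m N φ → boxSum m N φ ≡ boxSum m N (flip φ)
boxSum-sym zero    N       φ = refl
boxSum-sym (suc m) zero    φ = refl
boxSum-sym (suc m) (suc N) φ = trans
  (cong₂ _+_ (boxSum-sym m (suc N) _) (boxSum-sym (suc m) N _))
  (sym (boxSum-last m N (flip φ)))

-- The weakly decreasing words of length suc l with letters below M; g receives
-- the last letter, the sum, and the sum of the complements with respect to N.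
runSum : ℕ → ℕ → ℕ → (ℕ → ℕ → ℕ → ℕ) → ℕ
runSum N zero    M g = ∑< M (λ i → g i i (N ∸ suc i))
runSum N (suc l) M g = ∑< M (λ i → runSum N l (suc i) (λ e u v → g e (i + u) (N ∸ suc i + v)))

runSum-cong : ∀ {g g′} N l M → (∀ e u v → e < M → g e u v ≡ g′ e u v) →
              runSum N l M g ≡ runSum N l M g′
runSum-cong N zero    M e = ∑<-cong M (λ i i<M → e i _ _ i<M)
runSum-cong N (suc l) M e = ∑<-cong M (λ i i<M →
  runSum-cong N l (suc i) (λ j u v j<i → e j _ _ (<-≤-trans j<i i<M)))

runSum-+ : ∀ {g g′} N l M → runSum N l M (λ e u v → g e u v + g′ e u v) ≡
                            runSum N l M g + runSum N l M g′
runSum-+ N zero    M = ∑-+ (downFrom M)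
runSum-+ N (suc l) M = trans (∑<-cong M (λ i _ → runSum-+ N l (suc i))) (∑-+ (downFrom M))

-- Splits off the last letter instead of the first, since inclusion-exclusion prolongs a run at its
-- end.
runSum-snoc : ∀ N l M g → runSum N (suc l) M g ≡
  runSum N l M (λ e u v → ∑< (suc e) (λ j → g j (u + j) (v + (N ∸ suc j))))
runSum-snoc N zero    M g = refl
runSum-snoc N (suc l) M g = ∑<-cong M (λ i _ → trans
  (runSum-snoc N l (suc i) (λ e u v → g e (i + u) (N ∸ suc i + v)))
  (runSum-cong N l (suc i) (λ e u v _ → ∑<-cong (suc e) (λ j _ →
    cong₂ (g j) (sym (+-assoc i u j)) (sym (+-assoc (N ∸ suc i) v _))))))

-- Complements with respect to k + M exceed those with respect to M by k at each of the `suc l`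
-- letters. A free k lets M decrease in the induction while k + M stays fixed.
runSum-boxSum : ∀ k l M φ → runSum (k + M) l M (λ _ → φ) ≡
                            boxSum (suc l) M (λ u v → φ u (v + suc l * k))
runSum-boxSum k zero    zero    φ = refl
runSum-boxSum k (suc l) zero    φ = refl
runSum-boxSum k zero    (suc M) φ = cong₂ _+_
  (cong₂ φ (sym (+-identityʳ M)) (trans (m+n∸n≡m k (suc M)) (sym (+-identityʳ k))))
  (trans (cong (λ N → runSum N zero M (λ _ → φ)) (+-suc k M))
    (trans (runSum-boxSum (suc k) zero M φ)
      (boxSum-ext 1 M (λ u v → cong (φ u) (+-suc v (k + 0))))))
runSum-boxSum k (suc l) (suc M) φ = cong₂ _+_
  (trans (runSum-boxSum k l (suc M) _)
    (boxSum-ext (suc l) (suc M) (λ u v → cong (φ (M + u))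
      (trans (cong (_+ (v + suc l * k)) (m+n∸n≡m k (suc M))) (lemma₁ k l v)))))
  (trans (cong (λ N → runSum N (suc l) M (λ _ → φ)) (+-suc k M))
    (trans (runSum-boxSum (suc k) (suc l) M φ)
      (boxSum-ext (2 + l) M (λ u v → cong (φ u) (lemma₂ k l v)))))
  where
  lemma₁ : ∀ k l v → k + (v + suc l * k) ≡ v + suc (suc l) * k
  lemma₁ = solve-∀
  lemma₂ : ∀ k l v → v + suc (suc l) * suc k ≡ 2 + l + v + suc (suc l) * k
  lemma₂ = solve-∀

runSum-sym : ∀ N l φ → runSum N l N (λ _ → φ) ≡ runSum N l N (λ _ → flip φ)
runSum-sym N l φ = trans (runSum-boxSum 0 l N φ)
  (trans (boxSum-ext (suc l) N (λ u v → cong (φ u) (drop v)))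
  (trans (boxSum-sym (suc l) N φ)
  (trans (boxSum-ext (suc l) N (λ u v → cong (λ z → φ z u) (sym (drop v))))
         (sym (runSum-boxSum 0 l N (flip φ))))))
  where
  drop : ∀ v → v + suc l * 0 ≡ v
  drop v = trans (cong (v +_) (*-zeroʳ (suc l))) (+-identityʳ v)

-- Free words with prescribed ascents

wordSum : List ℕ → (List ℕ → ℕ) → ℕ
wordSum []       Ψ = Ψ []
wordSum (N ∷ Ns) Ψ = ∑< N (λ i → wordSum Ns (λ c → Ψ (i ∷ c)))

data Below : List ℕ → List ℕ → Set where
  []  : Below [] []
  _∷_ : ∀ {i N c Ns} → i < N → Below c Ns → Below (i ∷ c) (N ∷ Ns)

wordSum-cong : ∀ {Ψ Ψ′} Ns → (∀ c → Below c Ns → Ψ c ≡ Ψ′ c) → wordSum Ns Ψ ≡ wordSum Ns Ψ′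
wordSum-cong []       e = e [] []
wordSum-cong (N ∷ Ns) e = ∑<-cong N (λ i i<N → wordSum-cong Ns (λ c p → e (i ∷ c) (i<N ∷ p)))

ascents : List ℕ → List Bool
ascents (i ∷ j ∷ c) = (i <ᵇ j) ∷ ascents (j ∷ c)
ascents _           = []

cosum : ℕ → List ℕ → ℕ
cosum N c = sum (map (λ i → N ∸ suc i) c)

<ᵇ-true : ∀ {m n} → m < n → (m <ᵇ n) ≡ true
<ᵇ-true {m} {n} p with m <ᵇ n | <⇒<ᵇ p
... | true | _ = refl

<ᵇ-false : ∀ {m n} → n ≤ m → (m <ᵇ n) ≡ false
<ᵇ-false {m} {n} p with m <ᵇ n in eq
... | false = refl
... | true  = contradiction (<ᵇ⇒< m n (subst T (sym eq) _)) (≤⇒≯ p)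

-- Inclusion–exclusion at one place, with the subtracted terms moved across.
∑<-ascent : ∀ (g : Bool → ℕ → ℕ) e k →
  ∑< (k + suc e) (λ j → g (e <ᵇ j) j) + ∑< (suc e) (g true) ≡
  ∑< (suc e) (g false) + ∑< (k + suc e) (g true)
∑<-ascent g e zero    = cong (_+ ∑< (suc e) (g true))
  (∑<-cong (suc e) (λ j j≤e → cong (λ b → g b j) (<ᵇ-false (s≤s⁻¹ j≤e))))
∑<-ascent g e (suc k) = begin
  g (e <ᵇ (k + suc e)) (k + suc e) + A + B
    ≡⟨ cong (λ b → g b (k + suc e) + A + B) (<ᵇ-true (m≤n+m (suc e) k)) ⟩
  g true (k + suc e) + A + B       ≡⟨ +-assoc (g true (k + suc e)) A B ⟩
  g true (k + suc e) + (A + B)     ≡⟨ cong (g true (k + suc e) +_) (∑<-ascent g e k) ⟩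
  g true (k + suc e) + (C + D)     ≡⟨ x∙yz≈y∙xz (g true (k + suc e)) C D ⟩
  C + (g true (k + suc e) + D)     ∎
  where
  open ≡-Reasoning
  A = ∑< (k + suc e) (λ j → g (e <ᵇ j) j)
  B = ∑< (suc e) (g true)
  C = ∑< (suc e) (g false)
  D = ∑< (k + suc e) (g true)

module _ (N : ℕ) where

  private
    Weight : Set
    Weight = List Bool → ℕ → ℕ → ℕ

    -- A weakly decreasing run of length suc l followed by r free letters;
    -- the ascents are recorded from the last letter of the run onwards.
    runWord : ℕ → ℕ → Weight → ℕ
    runWord l r Ω = runSum N l N (λ e u v → wordSum (replicate r N)
                      (λ c → Ω (ascents (e ∷ c)) (u + sum c) (v + cosum N c)))

    -- Unlike in `runWord`, the step from the run to the word is not recorded, so the two are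
    -- independent.
    runThenWord : ℕ → ℕ → Weight → ℕ
    runThenWord l r Ω = runSum N l N (λ e u v → wordSum (replicate r N)
                          (λ c → Ω (ascents c) (u + sum c) (v + cosum N c)))

    swapped : Weight → Weight
    swapped Ω p u v = Ω p v u

    runWord-extend : ∀ l r Ω → runWord (suc l) r Ω ≡
      runSum N l N (λ e u v → ∑< (suc e) (λ j → wordSum (replicate r N)
        (λ c → Ω (ascents (j ∷ c)) (u + (j + sum c)) (v + (N ∸ suc j + cosum N c)))))
    runWord-extend l r Ω = trans (runSum-snoc N l N (λ e u v → wordSum (replicate r N)
        (λ c → Ω (ascents (e ∷ c)) (u + sum c) (v + cosum N c))))
      (runSum-cong N l N (λ e u v _ → ∑<-cong (suc e) (λ j _ →
        wordSum-cong (replicate r N) (λ c _ →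
          cong₂ (Ω (ascents (j ∷ c))) (+-assoc u j _) (+-assoc v (N ∸ suc j) _)))))

    -- The first free letter j either prolongs the run, when j ≤ e, or makes an ascent; the
    -- ascending choices are all choices minus the prolonging ones.
    runWord-split : ∀ l r Ω →
      runWord l (suc r) Ω + runWord (suc l) r (Ω ∘ (true ∷_)) ≡
      runWord (suc l) r (Ω ∘ (false ∷_)) + runThenWord l (suc r) (Ω ∘ (true ∷_))
    runWord-split l r Ω = begin
      runWord l (suc r) Ω + runWord (suc l) r (Ω ∘ (true ∷_))
        ≡⟨ cong (runWord l (suc r) Ω +_) (runWord-extend l r (Ω ∘ (true ∷_))) ⟩
      _ ≡⟨ sym (runSum-+ N l N) ⟩
      _ ≡⟨ runSum-cong N l N (λ e u v e<N →
             subst (λ M → ∑< M (λ j → g u v (e <ᵇ j) j) + ∑< (suc e) (g u v true) ≡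
                          ∑< (suc e) (g u v false) + ∑< M (g u v true))
                   -- Writes N as (N ∸ suc e) + suc e, the bound in `∑<-ascent`.
                   (m∸n+n≡m e<N) (∑<-ascent (g u v) e (N ∸ suc e))) ⟩
      _ ≡⟨ runSum-+ N l N ⟩
      _ ≡⟨ cong (_+ runThenWord l (suc r) (Ω ∘ (true ∷_))) (sym (runWord-extend l r (Ω ∘ (false ∷_)))) ⟩
      runWord (suc l) r (Ω ∘ (false ∷_)) + runThenWord l (suc r) (Ω ∘ (true ∷_)) ∎
      where
      open ≡-Reasoning
      g : ℕ → ℕ → Bool → ℕ → ℕ
      g u v b j = wordSum (replicate r N)
        (λ c → Ω (b ∷ ascents (j ∷ c)) (u + (j + sum c)) (v + (N ∸ suc j + cosum N c)))

    -- Induction on the number of free letters: in `runWord-split` the other three terms have either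
    -- fewer free letters or an unrecorded step after the run.
    runWord-sym : ∀ r l Ω → runWord l r Ω ≡ runWord l r (swapped Ω)
    runWord-sym zero    l Ω = runSum-sym N l (λ u v → Ω [] (u + 0) (v + 0))
    runWord-sym (suc r) l Ω = +-cancelʳ-≡ (runWord (suc l) r (Ω ∘ (true ∷_))) _ _ (begin
      runWord l (suc r) Ω + runWord (suc l) r (Ω ∘ (true ∷_))
        ≡⟨ runWord-split l r Ω ⟩
      runWord (suc l) r (Ω ∘ (false ∷_)) + runThenWord l (suc r) (Ω ∘ (true ∷_))
        ≡⟨ cong₂ _+_ (runWord-sym r (suc l) (Ω ∘ (false ∷_))) runThenWord-sym ⟩
      runWord (suc l) r (swapped Ω ∘ (false ∷_)) + runThenWord l (suc r) (swapped Ω ∘ (true ∷_))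
        ≡⟨ sym (runWord-split l r (swapped Ω)) ⟩
      runWord l (suc r) (swapped Ω) + runWord (suc l) r (swapped Ω ∘ (true ∷_))
        ≡⟨ cong (runWord l (suc r) (swapped Ω) +_) (sym (runWord-sym r (suc l) (Ω ∘ (true ∷_)))) ⟩
      runWord l (suc r) (swapped Ω) + runWord (suc l) r (Ω ∘ (true ∷_)) ∎)
      where
      open ≡-Reasoning
      runThenWord-sym : runThenWord l (suc r) (Ω ∘ (true ∷_)) ≡ runThenWord l (suc r) (swapped Ω ∘ (true ∷_))
      runThenWord-sym = trans
        -- The detached word is itself a run of one letter with r free letters, so the induction
        -- hypothesis exchanges its weights; `runSum-sym` then exchanges those of the run.
        (runSum-cong N l N (λ e u v _ → runWord-sym r 0 (λ p u′ v′ → Ω (true ∷ p) (u + u′) (v + v′))))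
        (runSum-sym N l _)

  wordSum-sym : ∀ r (Ω : List Bool → ℕ → ℕ → ℕ) →
    wordSum (replicate r N) (λ c → Ω (ascents c) (sum c) (cosum N c)) ≡
    wordSum (replicate r N) (λ c → Ω (ascents c) (cosum N c) (sum c))
  wordSum-sym zero    Ω = refl
  wordSum-sym (suc r) Ω = runWord-sym r 0 Ω

-- Indicators and weakly decreasing sequences along a permutation

ι : ∀ {P : Set} → Dec P → ℕ
ι P? = b2n (does P?)

ι-cong : ∀ {P Q : Set} (P? : Dec P) (Q? : Dec Q) → (P → Q) → (Q → P) → ι P? ≡ ι Q?
ι-cong P? Q? to from = cong b2n (does-⇔ (mk⇔ to from) P? Q?)

b2n-∧ : ∀ x y → b2n (x ∧ y) ≡ b2n x * b2n y
b2n-∧ false y = refl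
b2n-∧ true  y = sym (+-identityʳ (b2n y))

∑<-restrict : ∀ {K} N (g : ℕ → ℕ) → K ≤ N → ∑< N (λ j → ι (j <? K) * g j) ≡ ∑< K g
∑<-restrict {K} N g K≤N with m≤n⇒m<n∨m≡n K≤N
... | inj₂ refl = ∑<-cong N (λ j j<N → trans
        (cong (λ b → b2n b * g j) (dec-true (j <? N) j<N)) (+-identityʳ (g j)))
∑<-restrict {K} (suc N) g _ | inj₁ (s≤s K≤N) = cong₂ _+_
  (cong (λ b → b2n b * g N) (dec-false (N <? K) (≤⇒≯ K≤N)))
  (∑<-restrict N g K≤N)

des≤length : ∀ x p → des (x ∷ p) ≤ length p
des≤length x []      = z≤n
des≤length x (y ∷ p) = +-mono-≤ (b2n≤1 (y <ᵇ x)) (des≤length y p)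
  where
  b2n≤1 : ∀ b → b2n b ≤ 1
  b2n≤1 true  = ≤-refl
  b2n≤1 false = z≤n

-- Moving all positions up by one adds one per descent; hence `majFrom 0` is MAJ - des.
majFrom-suc : ∀ i w → majFrom (suc i) w ≡ majFrom i w + des w
majFrom-suc i []          = refl
majFrom-suc i (x ∷ [])    = refl
majFrom-suc i (x ∷ y ∷ r) with y <ᵇ x | majFrom-suc (suc i) (y ∷ r)
... | true  | ih = trans (cong (suc i +_) ih) (lemma i _ _)
  where
  lemma : ∀ i a b → suc i + (a + b) ≡ i + a + suc b
  lemma = solve-∀
... | false | ih = ih

majFrom-0-∷ : ∀ x y r → majFrom 0 (x ∷ y ∷ r) ≡ majFrom 0 (y ∷ r) + des (y ∷ r)
majFrom-0-∷ x y r with y <ᵇ x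
... | true  = majFrom-suc 0 (y ∷ r)
... | false = majFrom-suc 0 (y ∷ r)

-- Sequences c₁ ≥ c₂ ≥ ⋯ along a word w, with c₁ = N − 1 and cᵢ > cᵢ₊₁ at the
-- descents of w; φ receives c₂ + c₃ + ⋯.
chainSum : List ℕ → ℕ → (ℕ → ℕ) → ℕ
chainSum (x ∷ y ∷ p) N φ = ∑< (N ∸ b2n (y <ᵇ x)) (λ j → chainSum (y ∷ p) (suc j) (λ u → φ (j + u)))
chainSum _           N φ = φ 0

-- Substitute j = d + c₁ with c₁ the first letter of the longer word. For j < d the bound
-- `suc j ∸ d` is 0 and the sum vanishes, because d ≤ m makes the word nonempty.
∑<-boxSum : ∀ m d M φ N → d ≤ m →
  ∑< N (λ j → boxSum m (suc j ∸ d) (λ u _ → φ (j + (M + u)))) ≡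
  boxSum (suc m) (N ∸ d) (λ u _ → φ (M + d + u))
∑<-boxSum m d M φ zero    d≤m = cong (λ z → boxSum (suc m) z (λ u _ → φ (M + d + u))) (sym (0∸n≡0 d))
∑<-boxSum m d M φ (suc N) d≤m with d ≤? N
... | yes d≤N rewrite +-∸-assoc 1 d≤N = cong₂ _+_
  (boxSum-ext m (suc (N ∸ d)) (λ u _ → cong φ (trans
    (cong (_+ (M + u)) (sym (m∸n+n≡m d≤N))) (lemma (N ∸ d) d M u))))
  (∑<-boxSum m d M φ N d≤m)
  where
  lemma : ∀ k d M u → k + d + (M + u) ≡ M + d + (k + u)
  lemma = solve-∀
... | no d≰N rewrite m≤n⇒m∸n≡0 (≰⇒> d≰N) = cong₂ _+_
  (boxSum-empty m (λ u _ → φ (N + (M + u))) (≤-trans (s≤s z≤n) (≤-trans (≰⇒> d≰N) d≤m)))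
  (trans (∑<-boxSum m d M φ N d≤m)
    (cong (λ z → boxSum (suc m) z (λ u _ → φ (M + d + u))) (m≤n⇒m∸n≡0 (<⇒≤ (≰⇒> d≰N)))))

-- Subtracting from cᵢ the number of descents at or after i leaves a weakly decreasing word.
chainSum-boxSum : ∀ x p N φ → chainSum (x ∷ p) N φ ≡
  boxSum (length p) (N ∸ des (x ∷ p)) (λ u _ → φ (majFrom 0 (x ∷ p) + u))
chainSum-boxSum x []      N φ = refl
chainSum-boxSum x (y ∷ p) N φ = begin
  ∑< N′ (λ j → chainSum (y ∷ p) (suc j) (λ u → φ (j + u)))
    ≡⟨ ∑<-cong N′ (λ j _ → chainSum-boxSum y p (suc j) (λ u → φ (j + u))) ⟩
  ∑< N′ (λ j → boxSum (length p) (suc j ∸ des (y ∷ p)) (λ u _ → φ (j + (majFrom 0 (y ∷ p) + u))))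
    ≡⟨ ∑<-boxSum (length p) (des (y ∷ p)) (majFrom 0 (y ∷ p)) φ N′ (des≤length y p) ⟩
  boxSum (suc (length p)) (N′ ∸ des (y ∷ p)) (λ u _ → φ (majFrom 0 (y ∷ p) + des (y ∷ p) + u))
    ≡⟨ cong₂ (λ z M → boxSum (suc (length p)) z (λ u _ → φ (M + u)))
         (∸-+-assoc N (b2n (y <ᵇ x)) (des (y ∷ p))) (sym (majFrom-0-∷ x y p)) ⟩
  boxSum (suc (length p)) (N ∸ des (x ∷ y ∷ p)) (λ u _ → φ (majFrom 0 (x ∷ y ∷ p) + u)) ∎
  where
  open ≡-Reasoning
  N′ = N ∸ b2n (y <ᵇ x)

-- Functions on the letters and the permutations compatible with them

_[_≔_] : (ℕ → ℕ) → ℕ → ℕ → ℕ → ℕ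
(b [ x ≔ i ]) y with y ≟ x
... | yes _ = i
... | no  _ = b y

≔-same : ∀ b x i → (b [ x ≔ i ]) x ≡ i
≔-same b x i with x ≟ x
... | yes _   = refl
... | no  x≢x = contradiction refl x≢x

≔-other : ∀ b {x y} i → y ≢ x → (b [ x ≔ i ]) y ≡ b y
≔-other b {x} {y} i y≢x with y ≟ x
... | yes y≡x = contradiction y≡x y≢x
... | no  _   = refl

≔-ext : ∀ {b b′} x i → b ≗ b′ → (b [ x ≔ i ]) ≗ (b′ [ x ≔ i ])
≔-ext x i e y with y ≟ x
... | yes _ = refl
... | no  _ = e y

≔-comm : ∀ b {x y} i j → x ≢ y → (b [ x ≔ i ]) [ y ≔ j ] ≗ (b [ y ≔ j ]) [ x ≔ i ]
≔-comm b {x} {y} i j x≢y z with z ≟ y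
... | yes refl = sym (trans (≔-other (b [ y ≔ j ]) i (x≢y ∘ sym)) (≔-same b y j))
... | no  z≢y  with z ≟ x
...   | yes _ = refl
...   | no  _ = sym (≔-other b j z≢y)

Before : (ℕ → ℕ) → ℕ → ℕ → Set
Before b x y = b y < b x ⊎ (b x ≡ b y × x < y)

before? : ∀ b x y → Dec (Before b x y)
before? b x y = (b y <? b x) ⊎-dec ((b x ≟ b y) ×-dec (x <? y))

-- Only neighbours are compared, as in `chainSum`; transitivity of `Before b` extends this to all
-- pairs.
Compatible : (ℕ → ℕ) → List ℕ → Set
Compatible b = Linked (Before b)

compatible? : ∀ b w → Dec (Compatible b w)
compatible? b = linked? (before? b)

module Assignments (cap : ℕ → ℕ) where

  -- For distinct letters xs, this runs over the functions that agree with b off xs and lie below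
  -- `cap` on xs, each reached once by successive updates.
  assignSum : (ℕ → ℕ) → List ℕ → ((ℕ → ℕ) → ℕ) → ℕ
  assignSum b []       ψ = ψ b
  assignSum b (x ∷ xs) ψ = ∑< (cap x) (λ i → assignSum (b [ x ≔ i ]) xs ψ)

  record Reassigns (b : ℕ → ℕ) (xs : List ℕ) (b′ : ℕ → ℕ) : Set where
    constructor reassigns
    field
      inside  : ∀ {y} → y ∈ xs → b′ y < cap y
      outside : ∀ {y} → y ∉ xs → b′ y ≡ b y
  open Reassigns public

  Reassigns-∷ : ∀ {b x i xs b′} → i < cap x → Reassigns (b [ x ≔ i ]) xs b′ → Reassigns b (x ∷ xs) b′
  Reassigns-∷ {b} {x} {i} {xs} {b′} i<cap v = reassigns in′ out′
    where
    in′ : ∀ {y} → y ∈ x ∷ xs → b′ y < cap y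
    in′ (there y∈) = inside v y∈
    in′ (here refl) with x ∈? xs
    -- A later update of the same letter overrides the value i.
    ... | yes x∈ = inside v x∈
    ... | no  x∉ = subst (_< cap x) (sym (trans (outside v x∉) (≔-same b x i))) i<cap
    out′ : ∀ {y} → y ∉ x ∷ xs → b′ y ≡ b y
    out′ y∉ = trans (outside v (y∉ ∘ there)) (≔-other b i (y∉ ∘ here))

  assignSum-cong : ∀ {ψ ψ′} b xs → (∀ b′ → Reassigns b xs b′ → ψ b′ ≡ ψ′ b′) →
                   assignSum b xs ψ ≡ assignSum b xs ψ′
  assignSum-cong b []       e = e b (reassigns (λ ()) (λ _ → refl))
  assignSum-cong b (x ∷ xs) e = ∑<-cong (cap x) (λ i i<cap →
    assignSum-cong (b [ x ≔ i ]) xs (λ b′ → e b′ ∘ Reassigns-∷ i<cap))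

  assignSum-∑ : ∀ {A : Set} (ψ : A → (ℕ → ℕ) → ℕ) (ys : List A) b xs →
    ∑ ys (λ y → assignSum b xs (ψ y)) ≡ assignSum b xs (λ b′ → ∑ ys (λ y → ψ y b′))
  assignSum-∑ ψ ys b []       = refl
  assignSum-∑ ψ ys b (x ∷ xs) = trans (∑-swap ys (downFrom (cap x)))
    (∑<-cong (cap x) (λ i _ → assignSum-∑ ψ ys (b [ x ≔ i ]) xs))

  assignSum-++ : ∀ {ψ} b xs ys → assignSum b (xs ++ ys) ψ ≡ assignSum b xs (λ b′ → assignSum b′ ys ψ)
  assignSum-++ b []       ys = refl
  assignSum-++ b (x ∷ xs) ys = ∑<-cong (cap x) (λ i _ → assignSum-++ (b [ x ≔ i ]) xs ys)

  assignSum-*ˡ : ∀ c ψ b xs → assignSum b xs (λ b′ → c * ψ b′) ≡ c * assignSum b xs ψ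
  assignSum-*ˡ c ψ b []       = refl
  assignSum-*ˡ c ψ b (x ∷ xs) = trans
    (∑<-cong (cap x) (λ i _ → trans (assignSum-*ˡ c ψ (b [ x ≔ i ]) xs) (*-comm c _)))
    (trans (∑-*ʳ c (downFrom (cap x))) (*-comm _ c))

  module _ (ψ : (ℕ → ℕ) → ℕ) (ψ-ext : ∀ {b b′} → b ≗ b′ → ψ b ≡ ψ b′) where

    assignSum-ext : ∀ {b b′} xs → b ≗ b′ → assignSum b xs ψ ≡ assignSum b′ xs ψ
    assignSum-ext []       e = ψ-ext e
    assignSum-ext (x ∷ xs) e = ∑<-cong (cap x) (λ i _ → assignSum-ext xs (≔-ext x i e))

    -- Updates in another order yield functions that are only pointwise equal, which is why ψ has to
    -- respect `≗`.
    assignSum-↭ : ∀ {xs ys} b → xs ↭ ys → assignSum b xs ψ ≡ assignSum b ys ψ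
    assignSum-↭ b refl           = refl
    assignSum-↭ b (prep x p)     = ∑<-cong (cap x) (λ i _ → assignSum-↭ (b [ x ≔ i ]) p)
    assignSum-↭ b (↭-trans p q)    = trans (assignSum-↭ b p) (assignSum-↭ b q)
    assignSum-↭ b (swap {xs} x y p) with x ≟ y
    ... | yes refl = ∑<-cong (cap x) (λ i _ → ∑<-cong (cap x) (λ j _ →
                       assignSum-↭ ((b [ x ≔ i ]) [ x ≔ j ]) p))
    ... | no  x≢y  = trans (∑-swap (downFrom (cap x)) (downFrom (cap y)))
      (∑<-cong (cap y) (λ j _ → ∑<-cong (cap x) (λ i _ → trans
        (assignSum-ext xs (≔-comm b i j x≢y)) (assignSum-↭ ((b [ y ≔ j ]) [ x ≔ i ]) p))))

  -- Later updates leave the value at x alone because the letters are distinct; so the values along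
  -- xs form a free word.
  assignSum-wordSum : ∀ Ψ b xs → Unique xs →
    assignSum b xs (λ b′ → Ψ (map b′ xs)) ≡ wordSum (map cap xs) Ψ
  assignSum-wordSum Ψ b []       _        = refl
  assignSum-wordSum Ψ b (x ∷ xs) (x∉ ∷ u) = ∑<-cong (cap x) (λ i _ → trans
    (assignSum-cong (b [ x ≔ i ]) xs (λ b′ v → cong (λ z → Ψ (z ∷ map b′ xs))
      (trans (outside v (All.All¬⇒¬Any x∉)) (≔-same b x i))))
    (assignSum-wordSum (λ c → Ψ (i ∷ c)) (b [ x ≔ i ]) xs u))

  module _ (cap-mono : ∀ {x y} → x < y → cap x ≤ cap y) (cap-step : ∀ x y → cap x ≤ suc (cap y)) where

    -- Once the first value respects its cap, compatibility enforces all other caps: at an ascent of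
    -- the permutation the cap does not drop, and at a descent it drops by at most one while the
    -- value drops as well.
    assignSum-chainSum : ∀ φ b x p → Unique (x ∷ p) → b x < cap x →
      assignSum b p (λ b′ → ι (compatible? b′ (x ∷ p)) * φ (∑ p b′)) ≡ chainSum (x ∷ p) (suc (b x)) φ
    assignSum-chainSum φ b x []      _  _       = +-identityʳ (φ 0)
    assignSum-chainSum φ b x (y ∷ p) ((x≢y ∷ x∉p) ∷ u@(y∉p ∷ _)) bx<cap = begin
      ∑< (cap y) (λ j → assignSum (b [ y ≔ j ]) p
        (λ b′ → ι (compatible? b′ (x ∷ y ∷ p)) * φ (b′ y + ∑ p b′)))
        ≡⟨ ∑<-cong (cap y) (λ j j<cap → trans
             (assignSum-cong (b [ y ≔ j ]) p (step j))
             (trans (assignSum-*ˡ (ι (j <? K)) _ (b [ y ≔ j ]) p)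
               (cong (ι (j <? K) *_) (trans
                 (assignSum-chainSum (λ z → φ (j + z)) (b [ y ≔ j ]) y p u
                   (subst (_< cap y) (sym (≔-same b y j)) j<cap))
                 (cong (λ i → chainSum (y ∷ p) (suc i) (λ z → φ (j + z))) (≔-same b y j)))))) ⟩
      ∑< (cap y) (λ j → ι (j <? K) * chainSum (y ∷ p) (suc j) (λ z → φ (j + z)))
        ≡⟨ ∑<-restrict (cap y) _ K≤cap ⟩
      ∑< K (λ j → chainSum (y ∷ p) (suc j) (λ z → φ (j + z))) ∎
      where
      open ≡-Reasoning
      -- The number of values allowed at y: those up to `b x` if x < y, and those strictly below it
      -- if y < x, where a tie would put y first.
      K = suc (b x) ∸ b2n (y <ᵇ x)
      K≤cap : K ≤ cap y
      K≤cap with <-cmp x y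
      ... | tri≈ _ x≡y _ = contradiction x≡y x≢y
      ... | tri< x<y _ _ rewrite <ᵇ-false (<⇒≤ x<y) = ≤-trans bx<cap (cap-mono x<y)
      ... | tri> _ _ y<x rewrite <ᵇ-true y<x = s≤s⁻¹ (≤-trans bx<cap (cap-step x y))
      before⇒< : ∀ {b′} j → b′ x ≡ b x → b′ y ≡ j → Before b′ x y → j < K
      before⇒< j ex refl r with <-cmp x y
      before⇒< j ex refl r | tri≈ _ x≡y _ = contradiction x≡y x≢y
      before⇒< j ex refl (inj₁ lt)       | tri< x<y _ _ rewrite <ᵇ-false (<⇒≤ x<y) | ex = m<n⇒m<1+n lt
      before⇒< j ex refl (inj₂ (eq , _)) | tri< x<y _ _ rewrite <ᵇ-false (<⇒≤ x<y) | ex = s≤s (≤-reflexive (sym eq))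
      before⇒< j ex refl (inj₁ lt)       | tri> _ _ y<x rewrite <ᵇ-true y<x | ex = lt
      before⇒< j ex refl (inj₂ (_ , lt)) | tri> _ _ y<x = contradiction lt (<-asym y<x)
      <⇒before : ∀ {b′} j → b′ x ≡ b x → b′ y ≡ j → j < K → Before b′ x y
      <⇒before j ex refl lt with <-cmp x y
      ... | tri≈ _ x≡y _ = contradiction x≡y x≢y
      ... | tri> _ _ y<x rewrite <ᵇ-true y<x | ex = inj₁ lt
      ... | tri< x<y _ _ rewrite <ᵇ-false (<⇒≤ x<y) | ex with m≤n⇒m<n∨m≡n (s≤s⁻¹ lt)
      ...   | inj₁ lt′ = inj₁ lt′
      ...   | inj₂ eq  = inj₂ (sym eq , x<y)
      step : ∀ j b′ → Reassigns (b [ y ≔ j ]) p b′ →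
             ι (compatible? b′ (x ∷ y ∷ p)) * φ (b′ y + ∑ p b′) ≡
             ι (j <? K) * (ι (compatible? b′ (y ∷ p)) * φ (j + ∑ p b′))
      step j b′ v = trans
        (cong₂ _*_ (trans (b2n-∧ (does (before? b′ x y)) _)
                     (cong (_* ι (compatible? b′ (y ∷ p)))
                       (ι-cong (before? b′ x y) (j <? K) (before⇒< j ex ey) (<⇒before j ex ey))))
                   (cong (λ z → φ (z + ∑ p b′)) ey))
        (*-assoc (ι (j <? K)) _ _)
        where
        ey : b′ y ≡ j
        ey = trans (outside v (All.All¬⇒¬Any y∉p)) (≔-same b y j)
        ex : b′ x ≡ b x
        ex = trans (outside v (All.All¬⇒¬Any x∉p)) (≔-other b j x≢y)

-- The linear relation between MAJ, STAT and des

below : ℕ → List ℕ → ℕ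
below x = countB (_<ᵇ x)

-- With the letters placed on a circle, the three patterns together say that c lies on
-- the arc from x up to y.
countB-cyclic : ∀ x y r → x ≢ y → x ∉ r → y ∉ r →
  countB (λ c → (y <ᵇ x) ∧ (x <ᵇ c)) r + countB (λ c → (x <ᵇ c) ∧ (c <ᵇ y)) r
    + countB (λ c → (c <ᵇ y) ∧ (y <ᵇ x)) r + below x r
  ≡ length r * b2n (y <ᵇ x) + below y r
countB-cyclic x y []      _   _   _   = refl
countB-cyclic x y (c ∷ r) x≢y x∉r y∉r = trans (regroup
    (b2n ((y <ᵇ x) ∧ (x <ᵇ c))) _ (b2n ((x <ᵇ c) ∧ (c <ᵇ y))) _ (b2n ((c <ᵇ y) ∧ (y <ᵇ x))) _ (b2n (c <ᵇ x)) _)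
  (trans (cong₂ _+_ head (countB-cyclic x y r x≢y (x∉r ∘ there) (y∉r ∘ there)))
           (interchange (b2n (y <ᵇ x)) (b2n (c <ᵇ y)) _ _))
  where
  regroup : ∀ a a′ b b′ c c′ d d′ → (a + a′) + (b + b′) + (c + c′) + (d + d′) ≡
                                    (a + b + c + d) + (a′ + b′ + c′ + d′)
  regroup = solve-∀
  head : b2n ((y <ᵇ x) ∧ (x <ᵇ c)) + b2n ((x <ᵇ c) ∧ (c <ᵇ y)) + b2n ((c <ᵇ y) ∧ (y <ᵇ x)) + b2n (c <ᵇ x)
         ≡ b2n (y <ᵇ x) + b2n (c <ᵇ y)
  head with <-cmp x y | <-cmp x c | <-cmp y c
  ... | tri≈ _ e _ | _ | _ = contradiction e x≢y
  ... | _ | tri≈ _ e _ | _ = contradiction (here e) x∉r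
  ... | _ | _ | tri≈ _ e _ = contradiction (here e) y∉r
  ... | tri< p _ _ | tri< q _ _ | tri< r _ _ rewrite <ᵇ-false (<⇒≤ p) | <ᵇ-true q | <ᵇ-false (<⇒≤ q) | <ᵇ-false (<⇒≤ r) = refl
  ... | tri< p _ _ | tri< q _ _ | tri> _ _ r rewrite <ᵇ-false (<⇒≤ p) | <ᵇ-true q | <ᵇ-false (<⇒≤ q) | <ᵇ-true r = refl
  ... | tri< p _ _ | tri> _ _ q | tri< r _ _ = contradiction (<-trans q p) (<-asym r)
  ... | tri< p _ _ | tri> _ _ q | tri> _ _ r rewrite <ᵇ-false (<⇒≤ p) | <ᵇ-true q | <ᵇ-false (<⇒≤ q) | <ᵇ-true r = refl
  ... | tri> _ _ p | tri< q _ _ | tri< r _ _ rewrite <ᵇ-true p | <ᵇ-true q | <ᵇ-false (<⇒≤ q) | <ᵇ-false (<⇒≤ r) = refl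
  ... | tri> _ _ p | tri< q _ _ | tri> _ _ r = contradiction (<-trans r p) (<-asym q)
  ... | tri> _ _ p | tri> _ _ q | tri< r _ _ rewrite <ᵇ-true p | <ᵇ-true q | <ᵇ-false (<⇒≤ q) | <ᵇ-false (<⇒≤ r) = refl
  ... | tri> _ _ p | tri> _ _ q | tri> _ _ r rewrite <ᵇ-true p | <ᵇ-true q | <ᵇ-false (<⇒≤ q) | <ᵇ-true r = refl

-- On 𝒮ₙ the term `below x p` is F - 1. By `countB-cyclic` the patterns at the first pair amount to
-- `length r * δ` plus the change from `below x r` to `below y r`, so these terms telescope along
-- the word.
MAJ+STAT : ∀ x p → Unique (x ∷ p) →
  MAJ (x ∷ p) + STAT (x ∷ p) + below x p ≡ (2 + length p) * des (x ∷ p)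
MAJ+STAT x []      _ = refl
MAJ+STAT x (y ∷ r) ((x≢y ∷ x∉r) ∷ u@(y∉r ∷ _)) = +-cancelʳ-≡ (below y r) _ _ (begin
  MAJ (x ∷ y ∷ r) + STAT (x ∷ y ∷ r) + (δ + below x r) + below y r
    ≡⟨ cong (λ z → z + STAT (x ∷ y ∷ r) + (δ + below x r) + below y r) maj ⟩
  (δ + (M + D)) + (δ + A + B + C + S) + (δ + below x r) + below y r
    ≡⟨ lemma₁ δ M D A B C S (below x r) (below y r) ⟩
  3 * δ + D + (A + B + C + below x r) + (M + S + below y r)
    ≡⟨ cong₂ (λ z t → 3 * δ + D + z + t)
         (countB-cyclic x y r x≢y (All.All¬⇒¬Any x∉r) (All.All¬⇒¬Any y∉r)) (MAJ+STAT y r u) ⟩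
  3 * δ + D + (length r * δ + below y r) + (2 + length r) * D
    ≡⟨ lemma₂ δ D (length r) (below y r) ⟩
  (3 + length r) * (δ + D) + below y r ∎)
  where
  open ≡-Reasoning
  δ = b2n (y <ᵇ x)
  M = MAJ (y ∷ r)
  D = des (y ∷ r)
  S = STAT (y ∷ r)
  A = countB (λ c → (y <ᵇ x) ∧ (x <ᵇ c)) r
  B = countB (λ c → (x <ᵇ c) ∧ (c <ᵇ y)) r
  C = countB (λ c → (c <ᵇ y) ∧ (y <ᵇ x)) r
  maj : MAJ (x ∷ y ∷ r) ≡ δ + (M + D)
  maj with y <ᵇ x
  ... | true  = cong suc (majFrom-suc 1 (y ∷ r))
  ... | false = majFrom-suc 1 (y ∷ r)
  lemma₁ : ∀ δ M D A B C S a b → (δ + (M + D)) + (δ + A + B + C + S) + (δ + a) + b ≡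
                                 3 * δ + D + (A + B + C + a) + (M + S + b)
  lemma₁ = solve-∀
  lemma₂ : ∀ δ D l b → 3 * δ + D + (l * δ + b) + (2 + l) * D ≡ (3 + l) * (δ + D) + b
  lemma₂ = solve-∀

-- Makes the truncated subtraction in `stat₀` exact.
des≤STAT : ∀ w → des w ≤ STAT w
des≤STAT []          = z≤n
des≤STAT (x ∷ [])    = z≤n
des≤STAT (x ∷ y ∷ r) = +-mono-≤
  (≤-trans (m≤m+n _ _) (≤-trans (m≤m+n _ _) (m≤m+n _ _))) (des≤STAT (y ∷ r))

-- The permutations as rearrangements of 1, ..., n

from : ℕ → ℕ → List ℕ
from a zero    = []
from a (suc m) = a ∷ from (suc a) m

∈-from⁻ : ∀ {y} a m → y ∈ from a m → a ≤ y × y < a + m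
∈-from⁻ a (suc m) (here refl) = ≤-refl , m<m+n a (s≤s z≤n)
∈-from⁻ a (suc m) (there y∈) with ∈-from⁻ (suc a) m y∈
... | a<y , y<a+m = <⇒≤ a<y , <-≤-trans y<a+m (≤-reflexive (sym (+-suc a m)))

∈-from⁺ : ∀ {y} a m → a ≤ y → y < a + m → y ∈ from a m
∈-from⁺ a zero    a≤y y<a+m = contradiction (<-≤-trans y<a+m (≤-reflexive (+-identityʳ a))) (≤⇒≯ a≤y)
∈-from⁺ a (suc m) a≤y y<a+m with m≤n⇒m<n∨m≡n a≤y
... | inj₁ a<y  = there (∈-from⁺ (suc a) m a<y (<-≤-trans y<a+m (≤-reflexive (+-suc a m))))
... | inj₂ refl = here refl

from-unique : ∀ a m → Unique (from a m)
from-unique a zero    = []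
from-unique a (suc m) = All.tabulate (λ y∈ → <⇒≢ (proj₁ (∈-from⁻ (suc a) m y∈))) ∷ from-unique (suc a) m

from-++ : ∀ a k m → from a (k + m) ≡ from a k ++ from (a + k) m
from-++ a zero    m = cong (λ z → from z m) (sym (+-identityʳ a))
from-++ a (suc k) m = cong (a ∷_) (trans (from-++ (suc a) k m)
  (cong (λ z → from (suc a) k ++ from z m) (sym (+-suc a k))))

map-from-const : ∀ {g : ℕ → ℕ} {c} a l → (∀ {x} → x ∈ from a l → g x ≡ c) → map g (from a l) ≡ replicate l c
map-from-const a zero    e = refl
map-from-const a (suc l) e = cong₂ _∷_ (e (here refl)) (map-from-const (suc a) l (e ∘ there))

length-from : ∀ a m → length (from a m) ≡ m
length-from a zero    = refl
length-from a (suc m) = cong suc (length-from (suc a) m)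

map-suc-upTo : ∀ m → map suc (upTo m) ≡ from 1 m
map-suc-upTo m = go 0 id m (λ _ → refl)
  where
  go : ∀ a g m → (∀ i → g i ≡ a + i) → map suc (applyUpTo g m) ≡ from (suc a) m
  go a g zero    e = refl
  go a g (suc m) e = cong₂ _∷_ (cong suc (trans (e 0) (+-identityʳ a)))
    (go (suc a) (g ∘ suc) m (λ i → trans (e (suc i)) (+-suc a i)))

filter-cong : ∀ {A : Set} {P Q : A → Set} (P? : Decidable P) (Q? : Decidable Q) xs →
  (∀ {x} → x ∈ xs → P x → Q x) → (∀ {x} → x ∈ xs → Q x → P x) → filter P? xs ≡ filter Q? xs
filter-cong P? Q? []       to fro = refl
filter-cong P? Q? (x ∷ xs) to fro
  with does (P? x) | does (Q? x) | does-⇔ (mk⇔ (to (here refl)) (fro (here refl))) (P? x) (Q? x)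
... | true  | true  | refl = cong (x ∷_) (filter-cong P? Q? xs (to ∘ there) (fro ∘ there))
... | false | false | refl = filter-cong P? Q? xs (to ∘ there) (fro ∘ there)

-- Pigeonhole: each element of xs uses up its own place in ys, and the lengths leave no place over.
unique-⊆-↭ : ∀ {A : Set} {xs ys : List A} → Unique xs → xs ⊆ ys → length ys ≤ length xs → xs ↭ ys
unique-⊆-↭ {xs = []}     {[]}  _        _     _   = refl
unique-⊆-↭ {xs = x ∷ xs} {ys} (x∉ ∷ u) xs⊆ys len with ∈-∃++ (xs⊆ys (here refl))
... | as , bs , refl = ↭-trans (prep x (unique-⊆-↭ u sub len′)) (↭-sym (shift x as bs))
  where
  sub : xs ⊆ as ++ bs
  sub {y} y∈ with ∈-++⁻ as (xs⊆ys (there y∈))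
  ... | inj₁ y∈as           = ∈-++⁺ˡ y∈as
  ... | inj₂ (here refl)    = contradiction y∈ (All.All¬⇒¬Any x∉)
  ... | inj₂ (there y∈bs)   = ∈-++⁺ʳ as y∈bs
  len′ : length (as ++ bs) ≤ length xs
  len′ = s≤s⁻¹ (subst (_≤ suc (length xs)) (↭-length (shift x as bs)) len)

unique-↭ : ∀ {A : Set} {xs ys : List A} → xs ↭ ys → Unique xs → Unique ys
unique-↭ refl         u                          = u
unique-↭ (prep x p)   (x∉ ∷ u)                   = All-resp-↭ p x∉ ∷ unique-↭ p u
unique-↭ (swap x y p) ((x≢y ∷ x∉) ∷ (y∉ ∷ u))    = ((x≢y ∘ sym) ∷ All-resp-↭ p y∉) ∷ (All-resp-↭ p x∉ ∷ unique-↭ p u)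
unique-↭ (↭-trans p q)  u                          = unique-↭ q (unique-↭ p u)

word : ∀ {n k} → Vec (Fin n) k → List ℕ
word v = map (λ i → suc (toℕ i)) (toList v)

allVecs-cartesian : ∀ n k → allVecs n (suc k) ≡ cartesianProductWith _∷_ (allFin n) (allVecs n k)
allVecs-cartesian n k = go (allFin n)
  where
  go : ∀ is → concatMap (λ i → map (i ∷_) (allVecs n k)) is ≡ cartesianProductWith _∷_ is (allVecs n k)
  go []       = refl
  go (i ∷ is) = cong (map (i ∷_) (allVecs n k) ++_) (go is)

∈-allVecs : ∀ {n k} (v : Vec (Fin n) k) → v ∈ allVecs n k
∈-allVecs         []      = here refl
∈-allVecs {n} {suc k} (i ∷ v) = subst (i ∷ v ∈_) (sym (allVecs-cartesian n k))
  (∈-cartesianProductWith⁺ _∷_ (∈-allFin i) (∈-allVecs v))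

allVecs-unique : ∀ n k → Unique (allVecs n k)
allVecs-unique n zero    = [] ∷ []
allVecs-unique n (suc k) = subst Unique (sym (allVecs-cartesian n k))
  (Unique.cartesianProductWith⁺ _∷_ ∷-injective (Unique.allFin⁺ n) (allVecs-unique n k))

suc-toℕ-injective : ∀ {n} {i j : Fin n} → suc (toℕ i) ≡ suc (toℕ j) → i ≡ j
suc-toℕ-injective = toℕ-injective ∘ suc-injective

toList-inj : ∀ {A : Set} {k} (v w : Vec A k) → toList v ≡ toList w → v ≡ w
toList-inj []      []      _    = refl
toList-inj (x ∷ v) (y ∷ w) e with List.∷-injective e
... | refl , e′ = cong (x ∷_) (toList-inj v w e′)

Sn-unique : ∀ n → Unique (Sn n)
Sn-unique n = Unique.map⁺ (λ {v} {w} e → toList-inj v w (map-injective suc-toℕ-injective e))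
                (Unique.filter⁺ _ (allVecs-unique n n))

-- With `∈-Sn⁺` and `Sn-unique`, this says that `Sn n` lists each rearrangement of 1, ..., n exactly
-- once.
∈-Sn⁻ : ∀ {n π} → π ∈ Sn n → π ↭ from 1 n
∈-Sn⁻ {n} π∈ with ∈-map⁻ word π∈
... | v , v∈ , refl = unique-⊆-↭ (Unique.map⁺ suc-toℕ-injective (proj₂ (∈-filter⁻ injective? {xs = allVecs n n} v∈))) sub
        (≤-reflexive (trans (length-from 1 n) (sym (trans (length-map _ (toList v)) (length-toList v)))))
  where
  injective? : Decidable (λ (v : Vec (Fin n) n) → Unique (toList v))
  injective? v = unique? Fin._≟_ (toList v)
  sub : word v ⊆ from 1 n
  sub y∈ with ∈-map⁻ _ y∈
  ... | i , _ , refl = ∈-from⁺ 1 n (s≤s z≤n) (s≤s (toℕ<n i))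

∈-Sn⁺ : ∀ {n π} → π ↭ from 1 n → π ∈ Sn n
∈-Sn⁺ {n} {π} p = go (trans (↭-length p) (length-from 1 n))
                     (All.tabulate (∈-from⁻ 1 n ∘ ∈-resp-↭ p))
  where
  unword : ∀ {k} w → length w ≡ k → All (λ x → 1 ≤ x × x < suc n) w → ∃ λ (v : Vec (Fin n) k) → word v ≡ w
  unword []          refl []                     = [] , refl
  unword (suc x ∷ w) refl ((_ , s≤s x<n) ∷ ps) with unword w refl ps
  ... | v , e = fromℕ< x<n ∷ v , cong₂ _∷_ (cong suc (toℕ-fromℕ< x<n)) e
  go : length π ≡ n → All (λ x → 1 ≤ x × x < suc n) π → π ∈ Sn n
  go len ps with unword π len ps
  ... | v , e = subst (_∈ Sn n) e (∈-map⁺ word (∈-filter⁺ _ (∈-allVecs v)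
                  (Unique.map⁻ (subst Unique (sym e) (unique-↭ (↭-sym p) (from-unique 1 n))))))

-- Sorting the letters by a function

module _ {b : ℕ → ℕ} where

  before-trans : ∀ {x y z} → Before b x y → Before b y z → Before b x z
  before-trans (inj₁ p)       (inj₁ q)        = inj₁ (<-trans q p)
  before-trans (inj₁ p)       (inj₂ (e , _))  = inj₁ (≤-<-trans (≤-reflexive (sym e)) p)
  before-trans (inj₂ (e , _)) (inj₁ q)        = inj₁ (<-≤-trans q (≤-reflexive (sym e)))
  before-trans (inj₂ (e , p)) (inj₂ (e′ , q)) = inj₂ (trans e e′ , <-trans p q)

  before-asym : ∀ {x y} → Before b x y → ¬ Before b y x
  before-asym (inj₁ p)       (inj₁ q)       = <-asym p q
  before-asym (inj₁ p)       (inj₂ (e , _)) = <⇒≢ p e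
  before-asym (inj₂ (e , _)) (inj₁ q)       = <⇒≢ q e
  before-asym (inj₂ (_ , p)) (inj₂ (_ , q)) = <-asym p q

  before-total : ∀ {x y} → x ≢ y → Before b x y ⊎ Before b y x
  before-total {x} {y} x≢y with <-cmp (b x) (b y) | <-cmp x y
  ... | tri< p _ _ | _          = inj₂ (inj₁ p)
  ... | tri> _ _ p | _          = inj₁ (inj₁ p)
  ... | tri≈ _ e _ | tri< p _ _ = inj₁ (inj₂ (e , p))
  ... | tri≈ _ e _ | tri> _ _ p = inj₂ (inj₂ (sym e , p))
  ... | tri≈ _ _ _ | tri≈ _ e _ = contradiction e x≢y

  -- Two different first letters would each have to come before the other.
  sorted-≡ : ∀ {xs ys} → AllPairs (Before b) xs → AllPairs (Before b) ys → xs ↭ ys → xs ≡ ys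
  sorted-≡ {[]}     {ys}     _        _        p = sym (↭-empty-inv (↭-sym p))
  sorted-≡ {x ∷ xs} {[]}     _        _        p = contradiction p ¬x∷xs↭[]
  sorted-≡ {x ∷ xs} {y ∷ ys} (x≺ ∷ s) (y≺ ∷ t) p
    with ∈-resp-↭ p (here refl) | ∈-resp-↭ (↭-sym p) (here refl)
  ... | here refl | _         = cong (x ∷_) (sorted-≡ s t (drop-∷ p))
  ... | there _   | here refl = cong (x ∷_) (sorted-≡ s t (drop-∷ p))
  ... | there x∈  | there y∈  = contradiction (All.lookup y≺ x∈) (before-asym (All.lookup x≺ y∈))

  insert-sorted : ∀ x ys → x ∉ ys → AllPairs (Before b) ys → ∃ λ zs → zs ↭ x ∷ ys × AllPairs (Before b) zs
  insert-sorted x []       _  _ = x ∷ [] , refl , [] ∷ []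
  insert-sorted x (y ∷ ys) x∉ (y≺ ∷ s) with before-total (x∉ ∘ here)
  ... | inj₁ x≺y = x ∷ y ∷ ys , refl , (x≺y ∷ All.map (before-trans x≺y) y≺) ∷ (y≺ ∷ s)
  ... | inj₂ y≺x with insert-sorted x ys (x∉ ∘ there) s
  ...   | zs , p , t = y ∷ zs , ↭-trans (prep y p) (swap y x refl) , All-resp-↭ (↭-sym p) (y≺x ∷ y≺) ∷ t

  -- Existence, by insertion; with `sorted-≡`, each b is compatible with exactly one permutation.
  sort : ∀ xs → Unique xs → ∃ λ ys → ys ↭ xs × AllPairs (Before b) ys
  sort []       _        = [] , refl , []
  sort (x ∷ xs) (x∉ ∷ u) with sort xs u
  ... | ys , p , s with insert-sorted x ys (All.All¬⇒¬Any x∉ ∘ ∈-resp-↭ p) s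
  ...   | zs , q , t = zs , ↭-trans q (prep x p) , t

-- Inverse descents as rises of the function

pos-here : ∀ x w → pos x (x ∷ w) ≡ 1
pos-here x w rewrite dec-true (x ≟ x) refl = refl

pos-there : ∀ {x a} w → x ≢ a → pos x (a ∷ w) ≡ suc (pos x w)
pos-there {x} {a} w x≢a with x ≡ᵇ a | ≡ᵇ⇒≡ x a
... | true  | e = contradiction (e _) x≢a
... | false | _ = refl

pos-positive : ∀ {x w} → x ∈ w → 0 < pos x w
pos-positive {x} {a ∷ w} _ with x ≡ᵇ a
... | true  = s≤s z≤n
... | false = s≤s z≤n

pos-injective : ∀ {x y w} → x ∈ w → y ∈ w → pos x w ≡ pos y w → x ≡ y
pos-injective {x} {y} {a ∷ w} x∈ y∈ e with x ≟ a | y ≟ a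
... | yes refl | yes refl = refl
... | yes refl | no y≢a  rewrite pos-here x w | pos-there w y≢a =
        contradiction (suc-injective e) (<⇒≢ (pos-positive (Any.tail y≢a y∈)))
... | no x≢a | yes refl rewrite pos-here y w | pos-there w x≢a =
        contradiction (sym (suc-injective e)) (<⇒≢ (pos-positive (Any.tail x≢a x∈)))
pos-injective {x} {y} {a ∷ w} (here e)  _         _ | no x≢a | no _   = contradiction e x≢a
pos-injective {x} {y} {a ∷ w} (there _) (here e)  _ | no _   | no y≢a = contradiction e y≢a
pos-injective {x} {y} {a ∷ w} (there x∈) (there y∈) e | no x≢a | no y≢a
  rewrite pos-there w x≢a | pos-there w y≢a = pos-injective x∈ y∈ (suc-injective e)

pos-< : ∀ {R : ℕ → ℕ → Set} {x y w} → AllPairs R w → x ∈ w → y ∈ w → pos x w < pos y w → R x y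
pos-< {x = x} {y} {a ∷ w} (a≺ ∷ s) x∈ y∈ lt with x ≟ a | y ≟ a
... | yes refl | yes refl = contradiction lt (<-irrefl refl)
... | no x≢a   | yes refl rewrite pos-here y w | pos-there w x≢a = contradiction (s≤s⁻¹ lt) λ ()
pos-< (a≺ ∷ s) _ (here e)   lt | yes _    | no y≢a = contradiction e y≢a
pos-< (a≺ ∷ s) _ (there y∈) lt | yes refl | no y≢a = All.lookup a≺ y∈
pos-< (a≺ ∷ s) (here e)  _        lt | no x≢a | no _   = contradiction e x≢a
pos-< (a≺ ∷ s) (there _) (here e) lt | no _   | no y≢a = contradiction e y≢a
pos-< {w = a ∷ w} (a≺ ∷ s) (there x∈) (there y∈) lt | no x≢a | no y≢a
  rewrite pos-there w x≢a | pos-there w y≢a = pos-< s x∈ y∈ (s≤s⁻¹ lt)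

rises : (ℕ → ℕ) → ℕ → List ℕ
rises b m = filter (λ k → b k <? b (suc k)) (from 1 m)

-- A tie puts k before k + 1, so k + 1 stands to the left of k exactly when its value is strictly
-- larger.
Id-rises : ∀ {b m π} → π ↭ from 1 (suc m) → AllPairs (Before b) π → Id π ≡ rises b m
Id-rises {π = []}    p _ = contradiction (↭-sym p) ¬x∷xs↭[]
Id-rises {b} {m} {π@(x ∷ r)} p s = trans
  (cong (filter (λ k → pos (suc k) π <? pos k π))
    (trans (map-suc-upTo (length r)) (cong (from 1) (suc-injective (trans (↭-length p) (length-from 1 (suc m)))))))
  (filter-cong _ _ (from 1 m) to fro)
  where
  k∈ : ∀ {k} → k ∈ from 1 m → k ∈ π
  k∈ k∈ with ∈-from⁻ 1 m k∈
  ... | 1≤k , k<1+m = ∈-resp-↭ (↭-sym p) (∈-from⁺ 1 (suc m) 1≤k (m<n⇒m<1+n k<1+m))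
  sk∈ : ∀ {k} → k ∈ from 1 m → suc k ∈ π
  sk∈ k∈ with ∈-from⁻ 1 m k∈
  ... | 1≤k , k<1+m = ∈-resp-↭ (↭-sym p) (∈-from⁺ 1 (suc m) (s≤s z≤n) (s≤s k<1+m))
  to : ∀ {k} → k ∈ from 1 m → pos (suc k) π < pos k π → b k < b (suc k)
  to {k} k∈′ lt with pos-< s (sk∈ k∈′) (k∈ k∈′) lt
  ... | inj₁ q       = q
  ... | inj₂ (_ , q) = contradiction q (<-asym (n<1+n k))
  fro : ∀ {k} → k ∈ from 1 m → b k < b (suc k) → pos (suc k) π < pos k π
  fro {k} k∈′ q with <-cmp (pos (suc k) π) (pos k π)
  ... | tri< lt _ _ = lt
  ... | tri≈ _ e _  = contradiction (pos-injective (sk∈ k∈′) (k∈ k∈′) e) (<⇒≢ (n<1+n k) ∘ sym)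
  ... | tri> _ _ gt with pos-< s (k∈ k∈′) (sk∈ k∈′) gt
  ...   | inj₁ q′      = contradiction q (<-asym q′)
  ...   | inj₂ (e , _) = contradiction e (<⇒≢ q)

select : ℕ → List Bool → List ℕ
select a []       = []
select a (t ∷ ts) = if t then a ∷ select (suc a) ts else select (suc a) ts

-- The rises of b depend only on the ascent pattern of its word of values, which is what
-- `wordSum-sym` keeps fixed.
rises-select : ∀ b a m → filter (λ k → b k <? b (suc k)) (from a m) ≡ select a (ascents (map b (from a (suc m))))
rises-select b a zero    = refl
rises-select b a (suc m) with b a <ᵇ b (suc a) | rises-select b (suc a) m
... | true  | ih = cong (a ∷_) ih
... | false | ih = ih

-- Sums with indicators

ι-true : ∀ {P : Set} (P? : Dec P) → P → ι P? ≡ 1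
ι-true P? p = cong b2n (dec-true P? p)

ι-false : ∀ {P : Set} (P? : Dec P) → ¬ P → ι P? ≡ 0
ι-false P? ¬p = cong b2n (dec-false P? ¬p)

ι-*-cong : ∀ {P : Set} (P? : Dec P) {x y} → (P → x ≡ y) → ι P? * x ≡ ι P? * y
ι-*-cong (yes p) e = cong (_+ 0) (e p)
ι-*-cong (no _)  e = refl

length-filter : ∀ {A : Set} {P : A → Set} (P? : Decidable P) xs → length (filter P? xs) ≡ ∑ xs (λ x → ι (P? x))
length-filter P? []       = refl
length-filter P? (x ∷ xs) with does (P? x)
... | true  = cong suc (length-filter P? xs)
... | false = length-filter P? xs

∑-single : ∀ {A : Set} {g : A → ℕ} {xs x} → Unique xs → x ∈ xs → (∀ y → y ∈ xs → y ≢ x → g y ≡ 0) → ∑ xs g ≡ g x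
∑-single {g = g} {x ∷ xs} (x∉ ∷ u) (here refl) z = trans
  (cong (g x +_) (∑-zero xs (λ y y∈ → z y (there y∈) (λ { refl → All.All¬⇒¬Any x∉ y∈ }))))
  (+-identityʳ (g x))
∑-single {xs = y ∷ xs} (y∉ ∷ u) (there x∈) z = cong₂ _+_
  (z y (here refl) (λ { refl → All.All¬⇒¬Any y∉ x∈ }))
  (∑-single u x∈ (λ w → z w ∘ there))

∑-↭ : ∀ {A : Set} {g : A → ℕ} {xs ys} → xs ↭ ys → ∑ xs g ≡ ∑ ys g
∑-↭         refl         = refl
∑-↭ {g = g} (prep x p)   = cong (g x +_) (∑-↭ p)
∑-↭ {g = g} (swap x y p) = trans (cong (λ z → g x + (g y + z)) (∑-↭ p)) (x∙yz≈y∙xz (g x) (g y) _)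
∑-↭         (↭-trans p q)  = trans (∑-↭ p) (∑-↭ q)

∑-++ : ∀ {A : Set} {g : A → ℕ} xs ys → ∑ (xs ++ ys) g ≡ ∑ xs g + ∑ ys g
∑-++         []       ys = refl
∑-++ {g = g} (x ∷ xs) ys = trans (cong (g x +_) (∑-++ xs ys)) (sym (+-assoc (g x) _ _))

∑-sum : ∀ (b : ℕ → ℕ) xs → ∑ xs b ≡ sum (map b xs)
∑-sum b []       = refl
∑-sum b (x ∷ xs) = cong (b x +_) (∑-sum b xs)

-- Double counting with a fixed first letter

stat₀ : List ℕ → ℕ
stat₀ π = STAT π ∸ des π

MAJ≡ : ∀ π → MAJ π ≡ majFrom 0 π + des π
MAJ≡ = majFrom-suc 0

STAT≡ : ∀ π → STAT π ≡ stat₀ π + des π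
STAT≡ π = sym (m∸n+n≡m (des≤STAT π))

id-first? : ∀ S f π → Dec (Id π ≡ S × F π ≡ f)
id-first? S f π = ≡-dec _≟_ (Id π) S ×-dec (F π ≟ f)

module FirstLetter (f′ k s : ℕ) (S : List ℕ) where

  -- The first letter f has f′ smaller and k larger letters beside it; s is the value at f, and S
  -- the prescribed inverse descent set.
  m n f : ℕ
  m = f′ + k
  n = suc m
  f = suc f′

  smaller larger others : List ℕ
  smaller = from 1 f′
  larger  = from (suc f) k
  others  = smaller ++ larger

  letters : from 1 n ≡ smaller ++ f ∷ larger
  letters = trans (cong (from 1) (sym (+-suc f′ k))) (from-++ 1 f′ (suc k))

  letters-↭ : from 1 n ↭ f ∷ others
  letters-↭ = subst (_↭ f ∷ others) (sym letters) (shift f smaller larger)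

  f∷others-unique : Unique (f ∷ others)
  f∷others-unique = unique-↭ letters-↭ (from-unique 1 n)

  f∉others : f ∉ others
  f∉others with f∷others-unique
  ... | f∉ ∷ _ = All.All¬⇒¬Any f∉

  -- Exclusive bounds. A letter below f that ties with the value s would precede f, so it must stay
  -- below s; a larger letter may tie.
  cap : ℕ → ℕ
  cap x = if x <ᵇ f then s else suc s

  cap-< : ∀ {x} → x < f → cap x ≡ s
  cap-< x<f rewrite <ᵇ-true x<f = refl

  cap-≥ : ∀ {x} → f ≤ x → cap x ≡ suc s
  cap-≥ f≤x rewrite <ᵇ-false f≤x = refl

  cap≤ : ∀ x → cap x ≤ suc s
  cap≤ x with x <ᵇ f
  ... | true  = n≤1+n s
  ... | false = ≤-refl

  ≤cap : ∀ x → s ≤ cap x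
  ≤cap x with x <ᵇ f
  ... | true  = ≤-refl
  ... | false = n≤1+n s

  cap-mono : ∀ {x y} → x < y → cap x ≤ cap y
  cap-mono {x} {y} x<y with y <? f
  ... | yes y<f rewrite cap-< y<f | cap-< (<-trans x<y y<f) = ≤-refl
  ... | no  y≮f rewrite cap-≥ (≮⇒≥ y≮f) = cap≤ x

  cap-step : ∀ x y → cap x ≤ suc (cap y)
  cap-step x y = ≤-trans (cap≤ x) (s≤s (≤cap y))

  open Assignments cap

  -- Fixes the value s at f; the other letters receive theirs in `assignSum`.
  start : ℕ → ℕ
  start _ = s

  co : (ℕ → ℕ) → ℕ → ℕ
  co b x = cap x ∸ suc (b x)

  Rises : (ℕ → ℕ) → Set
  Rises b = rises b m ≡ S

  rises? : Decidable Rises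
  rises? b = ≡-dec _≟_ (rises b m) S

  module _ {b : ℕ → ℕ} (v : Reassigns start others b) where

    -- To precede f, a letter would need a value above s, or the value s and be smaller than f; the
    -- caps exclude both.
    F-sorted : ∀ {π} → π ↭ from 1 n → AllPairs (Before b) π → F π ≡ f
    F-sorted {[]}    p _        = contradiction (↭-sym p) ¬x∷xs↭[]
    F-sorted {x ∷ r} p (x≺ ∷ _) with ∈-resp-↭ (↭-sym (↭-trans p letters-↭)) (here refl)
    ... | here f≡x  = sym f≡x
    ... | there f∈r with ∈-resp-↭ (↭-trans p letters-↭) (here refl)
    ...   | here x≡f  = x≡f
    ...   | there x∈ = contradiction (All.lookup x≺ f∈r) ¬x≺f
      where
      bf≡s : b f ≡ s
      bf≡s = outside v f∉others
      ¬x≺f : ¬ Before b x f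
      ¬x≺f (inj₁ lt) rewrite bf≡s = contradiction lt (≤⇒≯ (s≤s⁻¹ (≤-trans (inside v x∈) (cap≤ x))))
      ¬x≺f (inj₂ (e , x<f)) = <⇒≢ (subst (b x <_) (cap-< x<f) (inside v x∈)) (trans e bf≡s)

    -- Only the permutation obtained by sorting with b contributes; its first letter is f and its
    -- inverse descent set is `rises b m`.
    ∑-compatible : ∑ (Sn n) (λ π → ι (id-first? S f π) * ι (compatible? b π)) ≡ ι (rises? b)
    ∑-compatible with sort {b} (from 1 n) (from-unique 1 n)
    ... | π , p , sorted = trans (∑-single (Sn-unique n) (∈-Sn⁺ p) others-zero)
          (trans (cong (ι (id-first? S f π) *_) (ι-true (compatible? b π) (AllPairs⇒Linked sorted)))
          (trans (*-identityʳ (ι (id-first? S f π)))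
          (ι-cong (id-first? S f π) (rises? b)
            (λ (Id≡S , _) → trans (sym (Id-rises p sorted)) Id≡S)
            (λ e → trans (Id-rises p sorted) e , F-sorted p sorted))))
      where
      others-zero : ∀ ρ → ρ ∈ Sn n → ρ ≢ π → ι (id-first? S f ρ) * ι (compatible? b ρ) ≡ 0
      others-zero ρ ρ∈ ρ≢π = trans (cong (ι (id-first? S f ρ) *_) (ι-false (compatible? b ρ)
        (λ c → ρ≢π (sorted-≡ (Linked⇒AllPairs (before-trans {b}) c) sorted (↭-trans (∈-Sn⁻ ρ∈) (↭-sym p))))))
        (*-zeroʳ (ι (id-first? S f ρ)))

  module _ (φ : ℕ → ℕ → ℕ) where

    weight : (ℕ → ℕ) → ℕ
    weight b = φ (∑ others b) (∑ others (co b))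

    box : List ℕ → ℕ
    box π = boxSum m (suc s ∸ des π) (λ u v → φ (majFrom 0 π + u) (stat₀ π + v))

    compatible-weight-ext : ∀ π {b b′} → b ≗ b′ →
      ι (compatible? b π) * weight b ≡ ι (compatible? b′ π) * weight b′
    compatible-weight-ext π {b} {b′} e = cong₂ _*_
      (ι-cong (compatible? b π) (compatible? b′ π) (Linked.map (move e)) (Linked.map (move (sym ∘ e))))
      (cong₂ φ (∑-cong others (λ x _ → e x))
               (∑-cong others (λ x _ → cong (λ z → cap x ∸ suc z) (e x))))
      where
      move : ∀ {b b′} → b ≗ b′ → ∀ {x y} → Before b x y → Before b′ x y
      move e {x} {y} (inj₁ p)       = inj₁ (subst₂ _<_ (e y) (e x) p)
      move e {x} {y} (inj₂ (q , p)) = inj₂ (trans (sym (e x)) (trans q (e y)) , p)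

    module _ {p : List ℕ} (p↭ : f ∷ p ↭ from 1 n) where

      private
        π = f ∷ p

        u : Unique π
        u = unique-↭ (↭-sym p↭) (from-unique 1 n)

        p↭others : p ↭ others
        p↭others = drop-∷ (↭-trans p↭ letters-↭)

        len : length p ≡ m
        len = suc-injective (trans (↭-length p↭) (length-from 1 n))

        -- The sum of cap x - 1 over the letters other than f, hence the constant value of
        -- `∑ p b + ∑ p (co b)`; `below f p` counts the caps equal to s.
        total : ℕ
        total = m * suc s ∸ (m + below f p)

        to-total : ∀ {t} → t + (m + below f p) ≡ m * suc s → t ≡ total
        to-total {t} e = trans (sym (m+n∸n≡m t (m + below f p))) (cong (_∸ (m + below f p)) e)

        ∑-cap : ∀ xs → ∑ xs cap + below f xs ≡ length xs * suc s
        ∑-cap []       = refl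
        ∑-cap (x ∷ xs) = trans (interchange (cap x) (∑ xs cap) (b2n (x <ᵇ f)) _) (cong₂ _+_ (step x) (∑-cap xs))
          where
          step : ∀ x → cap x + b2n (x <ᵇ f) ≡ suc s
          step x with x <ᵇ f
          ... | true  = +-comm s 1
          ... | false = +-identityʳ (suc s)

        ∑-co : ∀ b xs → (∀ {x} → x ∈ xs → b x < cap x) → ∑ xs b + ∑ xs (co b) + length xs ≡ ∑ xs cap
        ∑-co b []       _  = refl
        ∑-co b (x ∷ xs) lt = trans (lemma (b x) (∑ xs b) (co b x) _ (length xs))
          (cong₂ _+_ (m+[n∸m]≡n (lt (here refl))) (∑-co b xs (lt ∘ there)))
          where
          lemma : ∀ a A c C l → a + A + (c + C) + suc l ≡ suc a + c + (A + C + l)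
          lemma = solve-∀

        complement : ∀ {b} → Reassigns start p b → ∑ p (co b) ≡ total ∸ ∑ p b
        complement {b} v = trans (sym (m+n∸m≡n (∑ p b) _)) (cong (_∸ ∑ p b) (to-total (begin
          ∑ p b + ∑ p (co b) + (m + below f p)        ≡⟨ sym (+-assoc (∑ p b + ∑ p (co b)) m _) ⟩
          ∑ p b + ∑ p (co b) + m + below f p          ≡⟨ cong (λ l → ∑ p b + ∑ p (co b) + l + below f p) (sym len) ⟩
          ∑ p b + ∑ p (co b) + length p + below f p   ≡⟨ cong (_+ below f p) (∑-co b p (inside v)) ⟩
          ∑ p cap + below f p                         ≡⟨ ∑-cap p ⟩
          length p * suc s                            ≡⟨ cong (_* suc s) len ⟩
          m * suc s                                   ∎)))
          where open ≡-Reasoning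

        maj₀+stat₀ : majFrom 0 π + stat₀ π + below f p ≡ m * des π
        maj₀+stat₀ = +-cancelʳ-≡ (des π + des π) _ _ (begin
          majFrom 0 π + stat₀ π + below f p + (des π + des π)
            ≡⟨ lemma₁ (majFrom 0 π) (stat₀ π) (below f p) (des π) ⟩
          (majFrom 0 π + des π) + (stat₀ π + des π) + below f p
            ≡⟨ cong₂ (λ x y → x + y + below f p) (sym (MAJ≡ π)) (sym (STAT≡ π)) ⟩
          MAJ π + STAT π + below f p
            ≡⟨ MAJ+STAT f p u ⟩
          (2 + length p) * des π
            ≡⟨ cong (λ l → (2 + l) * des π) len ⟩
          (2 + m) * des π
            ≡⟨ lemma₂ m (des π) ⟩
          m * des π + (des π + des π) ∎)
          where
          open ≡-Reasoning
          lemma₁ : ∀ a b c d → a + b + c + (d + d) ≡ (a + d) + (b + d) + c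
          lemma₁ = solve-∀
          lemma₂ : ∀ m d → (2 + m) * d ≡ m * d + (d + d)
          lemma₂ = solve-∀

        des≤m : des π ≤ m
        des≤m = subst (des π ≤_) len (des≤length f p)

        -- Here STAT enters: by `maj₀+stat₀`, the complement of the shift `majFrom 0 π` is the shift
        -- `stat₀ π`.
        box-complement : ∀ u v → u + v + m ≡ m * (suc s ∸ des π) →
                         total ∸ (majFrom 0 π + u) ≡ stat₀ π + v
        box-complement u v e with des π ≤? suc s
        ... | yes d≤ = trans (cong (_∸ (majFrom 0 π + u)) (sym (to-total (begin
          majFrom 0 π + u + (stat₀ π + v) + (m + below f p)
            ≡⟨ lemma (majFrom 0 π) u (stat₀ π) v m (below f p) ⟩
          u + v + m + (majFrom 0 π + stat₀ π + below f p)
            ≡⟨ cong₂ _+_ e maj₀+stat₀ ⟩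
          m * (suc s ∸ des π) + m * des π
            ≡⟨ sym (*-distribˡ-+ m (suc s ∸ des π) (des π)) ⟩
          m * (suc s ∸ des π + des π)
            ≡⟨ cong (m *_) (m∸n+n≡m d≤) ⟩
          m * suc s ∎)))) (m+n∸m≡n (majFrom 0 π + u) (stat₀ π + v))
          where
          open ≡-Reasoning
          lemma : ∀ M u S v m B → M + u + (S + v) + (m + B) ≡ u + v + m + (M + S + B)
          lemma = solve-∀
        -- The box bound would be 0, so `e` forces m to be 0, and des π ≤ m contradicts des π > suc
        -- s.
        ... | no d≰ = contradiction (≤-trans des≤m (≤-trans (≤-reflexive m≡0) z≤n)) d≰
          where
          m≡0 : m ≡ 0
          m≡0 = m+n≡0⇒n≡0 (u + v) (trans e (trans
            (cong (m *_) (m≤n⇒m∸n≡0 (<⇒≤ (≰⇒> d≰)))) (*-zeroʳ m)))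

      -- Since `chainSum` records a single sum, the second weight is written as `total` minus the
      -- first and recovered by `box-complement`.
      box-assignSum : box π ≡ assignSum start others (λ b → ι (compatible? b π) * weight b)
      box-assignSum = sym (begin
        assignSum start others (λ b → ι (compatible? b π) * weight b)
          ≡⟨ sym (assignSum-↭ _ (compatible-weight-ext π) start p↭others) ⟩
        assignSum start p (λ b → ι (compatible? b π) * weight b)
          ≡⟨ assignSum-cong start p (λ b v → cong (ι (compatible? b π) *_)
               (cong₂ φ (sym (∑-↭ p↭others)) (trans (sym (∑-↭ p↭others)) (complement v)))) ⟩
        assignSum start p (λ b → ι (compatible? b π) * φ (∑ p b) (total ∸ ∑ p b))
          ≡⟨ assignSum-chainSum cap-mono cap-step (λ x → φ x (total ∸ x)) start f p u
               (≤-reflexive (sym (cap-≥ ≤-refl))) ⟩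
        chainSum π (suc s) (λ x → φ x (total ∸ x))
          ≡⟨ chainSum-boxSum f p (suc s) _ ⟩
        boxSum (length p) (suc s ∸ des π) (λ u _ → φ (majFrom 0 π + u) (total ∸ (majFrom 0 π + u)))
          ≡⟨ cong (λ l → boxSum l (suc s ∸ des π) (λ u _ → φ (majFrom 0 π + u) (total ∸ (majFrom 0 π + u)))) len ⟩
        boxSum m (suc s ∸ des π) (λ u _ → φ (majFrom 0 π + u) (total ∸ (majFrom 0 π + u)))
          ≡⟨ boxSum-cong m (suc s ∸ des π) (λ u v e → cong (φ (majFrom 0 π + u)) (box-complement u v e)) ⟩
        box π ∎)
        where open ≡-Reasoning

    -- Counts the compatible pairs of π and b twice: for fixed π the functions b make up `box π`,
    -- and for fixed b `∑-compatible` sums over π.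
    ∑-box : ∑ (Sn n) (λ π → ι (id-first? S f π) * box π) ≡ assignSum start others (λ b → ι (rises? b) * weight b)
    ∑-box = begin
      ∑ (Sn n) (λ π → ι (id-first? S f π) * box π)
        ≡⟨ ∑-cong (Sn n) (λ π π∈ → trans
             (ι-*-cong (id-first? S f π) (λ (_ , F≡f) → expand (∈-Sn⁻ π∈) F≡f))
             (sym (assignSum-*ˡ (ι (id-first? S f π)) _ start others))) ⟩
      ∑ (Sn n) (λ π → assignSum start others (λ b → ι (id-first? S f π) * (ι (compatible? b π) * weight b)))
        ≡⟨ assignSum-∑ _ (Sn n) start others ⟩
      assignSum start others (λ b → ∑ (Sn n) (λ π → ι (id-first? S f π) * (ι (compatible? b π) * weight b)))
        ≡⟨ assignSum-cong start others (λ b v → trans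
             (∑-cong (Sn n) (λ π _ → sym (*-assoc (ι (id-first? S f π)) _ (weight b))))
             (trans (∑-*ʳ (weight b) (Sn n)) (cong (_* weight b) (∑-compatible v)))) ⟩
      assignSum start others (λ b → ι (rises? b) * weight b) ∎
      where
      open ≡-Reasoning
      expand : ∀ {π} → π ↭ from 1 n → F π ≡ f →
               box π ≡ assignSum start others (λ b → ι (compatible? b π) * weight b)
      expand {x ∷ p} p↭ refl = box-assignSum p↭

  -- The steps at f are forced: from the last smaller letter up to s is always an ascent, from s to
  -- the first larger letter never. A step is absent when its side has no letters.
  afterSmaller : ℕ → List Bool → List Bool
  afterSmaller zero    t = t
  afterSmaller (suc _) t = true ∷ t

  beforeLarger : ℕ → List Bool → List Bool
  beforeLarger zero    t = []
  beforeLarger (suc _) t = false ∷ t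

  ascents-larger : ∀ {k} c → Below c (replicate k (suc s)) → ascents (s ∷ c) ≡ beforeLarger k (ascents c)
  ascents-larger {zero}  []      []        = refl
  ascents-larger {suc k} (j ∷ c) (j≤s ∷ _) = cong (_∷ ascents (j ∷ c)) (<ᵇ-false (s≤s⁻¹ j≤s))

  ascents-++ : ∀ {l} c d → Below c (replicate l s) →
               ascents (c ++ s ∷ d) ≡ ascents c ++ afterSmaller l (ascents (s ∷ d))
  ascents-++ {zero}        []          d []        = refl
  ascents-++ {suc zero}    (i ∷ [])    d (i<s ∷ _) = cong (_∷ ascents (s ∷ d)) (<ᵇ-true i<s)
  ascents-++ {suc (suc l)} (i ∷ j ∷ c) d (_ ∷ q)   = cong ((i <ᵇ j) ∷_) (ascents-++ (j ∷ c) d q)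

  cap-smaller : ∀ {x} → x ∈ smaller → cap x ≡ s
  cap-smaller x∈ = cap-< (proj₂ (∈-from⁻ 1 f′ x∈))

  cap-larger : ∀ {x} → x ∈ larger → cap x ≡ suc s
  cap-larger x∈ = cap-≥ (<⇒≤ (proj₁ (∈-from⁻ (suc f) k x∈)))

  ∑-co-cosum : ∀ {N} b xs → (∀ {x} → x ∈ xs → cap x ≡ N) → ∑ xs (co b) ≡ cosum N (map b xs)
  ∑-co-cosum b []       e = refl
  ∑-co-cosum b (x ∷ xs) e = cong₂ _+_ (cong (_∸ suc (b x)) (e (here refl))) (∑-co-cosum b xs (e ∘ there))

  riseWeight : (ℕ → ℕ → ℕ) → List Bool → List Bool → ℕ → ℕ → ℕ
  riseWeight φ t t′ u v =
    ι (≡-dec _≟_ (select 1 (t ++ afterSmaller f′ (beforeLarger k t′))) S) * φ u v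

  -- As the steps at f are forced, the values on the smaller and on the larger letters are two
  -- independent free words.
  assignSum-rises : ∀ φ → assignSum start others (λ b → ι (rises? b) * weight φ b) ≡
    wordSum (replicate f′ s) (λ c → wordSum (replicate k (suc s)) (λ d →
      riseWeight φ (ascents c) (ascents d) (sum c + sum d) (cosum s c + cosum (suc s) d)))
  assignSum-rises φ = begin
    assignSum start others (λ b → ι (rises? b) * weight φ b)
      ≡⟨ assignSum-cong start others (λ b v → cong₂ _*_
           (cong (λ ks → ι (≡-dec _≟_ ks S)) (rises-split v))
           (cong₂ φ
             (trans (∑-++ smaller larger) (cong₂ _+_ (∑-sum b smaller) (∑-sum b larger)))
             (trans (∑-++ smaller larger) (cong₂ _+_ (∑-co-cosum b smaller cap-smaller) (∑-co-cosum b larger cap-larger))))) ⟩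
    assignSum start others (λ b → G (map b smaller) (map b larger))
      ≡⟨ assignSum-++ start smaller larger ⟩
    assignSum start smaller (λ b → assignSum b larger (λ b′ → G (map b′ smaller) (map b′ larger)))
      ≡⟨ assignSum-cong start smaller (λ b _ → trans
           (assignSum-cong b larger (λ b′ v → cong (λ c → G c (map b′ larger))
             (map-cong-local (All.tabulate (λ x∈ → outside v (∉larger x∈))))))
           (assignSum-wordSum (G (map b smaller)) b larger (from-unique (suc f) k))) ⟩
    assignSum start smaller (λ b → wordSum (map cap larger) (G (map b smaller)))
      ≡⟨ assignSum-wordSum (λ c → wordSum (map cap larger) (G c)) start smaller (from-unique 1 f′) ⟩
    wordSum (map cap smaller) (λ c → wordSum (map cap larger) (G c))
      ≡⟨ cong₂ (λ Ns Ms → wordSum Ns (λ c → wordSum Ms (G c)))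
           (map-from-const 1 f′ cap-smaller) (map-from-const (suc f) k cap-larger) ⟩
    wordSum (replicate f′ s) (λ c → wordSum (replicate k (suc s)) (G c))
      ≡⟨ wordSum-cong (replicate f′ s) (λ c c< → wordSum-cong (replicate k (suc s)) (λ d d< →
           cong (λ t → ι (≡-dec _≟_ (select 1 t) S) * φ (sum c + sum d) (cosum s c + cosum (suc s) d))
             (trans (ascents-++ c d c<) (cong (λ t → ascents c ++ afterSmaller f′ t) (ascents-larger d d<))))) ⟩
    _ ∎
    where
    open ≡-Reasoning
    G : List ℕ → List ℕ → ℕ
    G c d = ι (≡-dec _≟_ (select 1 (ascents (c ++ s ∷ d))) S) * φ (sum c + sum d) (cosum s c + cosum (suc s) d)
    rises-split : ∀ {b} → Reassigns start others b →
                  rises b m ≡ select 1 (ascents (map b smaller ++ s ∷ map b larger))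
    rises-split {b} v = trans (rises-select b 1 m) (cong (select 1 ∘ ascents)
      (trans (cong (map b) letters) (trans (map-++ b smaller (f ∷ larger))
        (cong (λ z → map b smaller ++ z ∷ map b larger) (outside v f∉others)))))
    ∉larger : ∀ {x} → x ∈ smaller → x ∉ larger
    ∉larger x∈ x∈′ = <-asym (proj₂ (∈-from⁻ 1 f′ x∈)) (proj₁ (∈-from⁻ (suc f) k x∈′))

  -- The symmetry of free words is applied to the smaller letters and then to the larger ones.
  assignSum-rises-sym : ∀ φ → assignSum start others (λ b → ι (rises? b) * weight φ b) ≡
                              assignSum start others (λ b → ι (rises? b) * weight (flip φ) b)
  assignSum-rises-sym φ = trans (assignSum-rises φ) (trans
    (wordSum-sym s f′ (λ t u v → wordSum (replicate k (suc s)) (λ d →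
      riseWeight φ t (ascents d) (u + sum d) (v + cosum (suc s) d))))
    (trans
      (wordSum-cong (replicate f′ s) (λ c _ →
        wordSum-sym (suc s) k (λ t u v → riseWeight φ (ascents c) t (cosum s c + u) (sum c + v))))
      (sym (assignSum-rises (flip φ)))))

  ∑-box-sym : ∀ φ → ∑ (Sn n) (λ π → ι (id-first? S f π) * box φ π) ≡ ∑ (Sn n) (λ π → ι (id-first? S f π) * box (flip φ) π)
  ∑-box-sym φ = trans (∑-box φ) (trans (assignSum-rises-sym φ) (sym (∑-box (flip φ))))

-- From box sums to a fixed number of descents

-- Triangularity in δ: the objects with δ = d contribute a single term to the d-th box sum.
module _ {A : Set} (L : List A) (w δ α β : A → ℕ) (m : ℕ) (δ≤m : ∀ x → x ∈ L → δ x ≤ m)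
  (boxes-sym : ∀ (s : ℕ) (φ : ℕ → ℕ → ℕ) →
    ∑ L (λ x → w x * boxSum m (suc s ∸ δ x) (λ u v → φ (α x + u) (β x + v))) ≡
    ∑ L (λ x → w x * boxSum m (suc s ∸ δ x) (λ u v → φ (β x + v) (α x + u)))) where

  -- An arbitrary G that may depend on δ lets the induction hypothesis absorb whole box sums.
  ∑-sym-< : ∀ d (G : ℕ → ℕ → ℕ → ℕ) →
    ∑ L (λ x → w x * (ι (δ x <? d) * G (δ x) (α x) (β x))) ≡
    ∑ L (λ x → w x * (ι (δ x <? d) * G (δ x) (β x) (α x)))
  ∑-sym-< zero    G = ∑-cong L (λ _ _ → refl)
  ∑-sym-< (suc d) G = trans (split α β) (trans (cong₂ _+_ ∑-sym-≡ (∑-sym-< d G)) (sym (split β α)))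
    where
    open ≡-Reasoning
    split : ∀ (α β : A → ℕ) → ∑ L (λ x → w x * (ι (δ x <? suc d) * G (δ x) (α x) (β x))) ≡
      ∑ L (λ x → w x * (ι (δ x ≟ d) * G (δ x) (α x) (β x))) +
      ∑ L (λ x → w x * (ι (δ x <? d) * G (δ x) (α x) (β x)))
    split α β = trans (∑-cong L (λ x _ → trans
        (cong (w x *_) (trans (cong (_* G (δ x) (α x) (β x)) (ι-≤ (δ x)))
                                (*-distribʳ-+ (G (δ x) (α x) (β x)) (ι (δ x ≟ d)) _)))
        (*-distribˡ-+ (w x) _ _)))
      (∑-+ L)
      where
      ι-≤ : ∀ e → ι (e <? suc d) ≡ ι (e ≟ d) + ι (e <? d)
      ι-≤ e with <-cmp e d
      ... | tri< lt ne _ = trans (ι-true (e <? suc d) (m<n⇒m<1+n lt))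
                             (sym (cong₂ _+_ (ι-false (e ≟ d) ne) (ι-true (e <? d) lt)))
      ... | tri≈ nlt eq _ = trans (ι-true (e <? suc d) (s≤s (≤-reflexive eq)))
                             (sym (cong₂ _+_ (ι-true (e ≟ d) eq) (ι-false (e <? d) nlt)))
      ... | tri> nlt ne gt = trans (ι-false (e <? suc d) (≤⇒≯ gt))
                             (sym (cong₂ _+_ (ι-false (e ≟ d) ne) (ι-false (e <? d) nlt)))

    B : (A → ℕ) → (A → ℕ) → (ℕ → ℕ → ℕ) → A → ℕ
    B α β φ x = boxSum m (suc d ∸ δ x) (λ u v → φ (α x + u) (β x + v))

    -- For δ x = d the box bound is 1, which leaves only the zero word. For δ x > d it is 0, and δ x
    -- ≤ m makes the words nonempty, so the sum vanishes.
    B-split : ∀ (α β : A → ℕ) x → x ∈ L → B α β (G d) x ≡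
              ι (δ x ≟ d) * G (δ x) (α x) (β x) + ι (δ x <? d) * B α β (G d) x
    B-split α β x x∈ with <-cmp (δ x) d
    ... | tri< lt ne _ rewrite dec-false (δ x ≟ d) ne | dec-true (δ x <? d) lt = sym (+-identityʳ _)
    ... | tri≈ nlt refl _ rewrite dec-true (d ≟ d) refl | dec-false (d <? d) nlt | m+n∸n≡m 1 d =
          trans (boxSum-one m _) (trans (cong₂ (G d) (+-identityʳ (α x)) (+-identityʳ (β x)))
            (sym (trans (+-identityʳ _) (+-identityʳ _))))
    ... | tri> nlt ne gt rewrite dec-false (δ x ≟ d) ne | dec-false (δ x <? d) nlt | m≤n⇒m∸n≡0 gt =
          boxSum-empty m _ (≤-trans (≤-trans (s≤s z≤n) gt) (δ≤m x x∈))

    ∑-B : ∀ (α β : A → ℕ) → ∑ L (λ x → w x * B α β (G d) x) ≡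
      ∑ L (λ x → w x * (ι (δ x ≟ d) * G (δ x) (α x) (β x))) + ∑ L (λ x → w x * (ι (δ x <? d) * B α β (G d) x))
    ∑-B α β = trans (∑-cong L (λ x x∈ → trans (cong (w x *_) (B-split α β x x∈)) (*-distribˡ-+ (w x) _ _))) (∑-+ L)

    -- `boxes-sym` exchanges the shifts together with the inner weights; the symmetry of the box
    -- restores the inner weights.
    swap-B : ∀ x → boxSum m (suc d ∸ δ x) (λ u v → G d (β x + v) (α x + u)) ≡ B β α (G d) x
    swap-B x = boxSum-sym m (suc d ∸ δ x) _

    ∑-sym-≡ : ∑ L (λ x → w x * (ι (δ x ≟ d) * G (δ x) (α x) (β x))) ≡
              ∑ L (λ x → w x * (ι (δ x ≟ d) * G (δ x) (β x) (α x)))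
    ∑-sym-≡ = +-cancelʳ-≡ (∑ L (λ x → w x * (ι (δ x <? d) * B α β (G d) x))) _ _ (begin
      _ ≡⟨ sym (∑-B α β) ⟩
      ∑ L (λ x → w x * B α β (G d) x)
        ≡⟨ boxes-sym d (G d) ⟩
      ∑ L (λ x → w x * boxSum m (suc d ∸ δ x) (λ u v → G d (β x + v) (α x + u)))
        ≡⟨ ∑-cong L (λ x _ → cong (w x *_) (swap-B x)) ⟩
      ∑ L (λ x → w x * B β α (G d) x)
        ≡⟨ ∑-B β α ⟩
      _ ≡⟨ cong (∑ L (λ x → w x * (ι (δ x ≟ d) * G (δ x) (β x) (α x))) +_)
             -- For δ x < d the box sum is a function of δ x, α x and β x, so it can serve as G.
             (sym (∑-sym-< d (λ e a b → boxSum m (suc d ∸ e) (λ u v → G d (a + u) (b + v))))) ⟩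
      _ ∎)

-- The joint distribution

F∈from : ∀ {m π} → π ↭ from 1 (suc m) → F π ∈ from 1 (suc m)
F∈from {π = []}    p = contradiction (↭-sym p) ¬x∷xs↭[]
F∈from {π = x ∷ r} p = ∈-resp-↭ p (here refl)

des<n : ∀ {m π} → π ↭ from 1 (suc m) → des π ≤ m
des<n {π = []}    p = contradiction (↭-sym p) ¬x∷xs↭[]
des<n {m} {x ∷ r} p = subst (des (x ∷ r) ≤_)
  (suc-injective (trans (↭-length p) (length-from 1 (suc m)))) (des≤length x r)

∑-Sn-sym : ∀ m f S d (G : ℕ → ℕ → ℕ → ℕ) →
  ∑ (Sn (suc m)) (λ π → ι (id-first? S f π) * (ι (des π <? d) * G (des π) (majFrom 0 π) (stat₀ π))) ≡
  ∑ (Sn (suc m)) (λ π → ι (id-first? S f π) * (ι (des π <? d) * G (des π) (stat₀ π) (majFrom 0 π)))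
∑-Sn-sym m f S d G with (1 ≤? f) ×-dec (f <? suc (suc m))
-- With k = m ∸ f′ the number of larger letters, m becomes f′ + k as in `FirstLetter`.
∑-Sn-sym m (suc f′) S d G | yes (_ , s≤s (s≤s f′≤m)) with m ∸ f′ | m+[n∸m]≡n f′≤m
... | k | refl = ∑-sym-< (Sn (suc (f′ + k))) (λ π → ι (id-first? S (suc f′) π)) des (majFrom 0) stat₀ (f′ + k)
                   (λ π π∈ → des<n (∈-Sn⁻ π∈)) (λ s → FirstLetter.∑-box-sym f′ k s S) d G
-- F π is one of the letters 1, ..., suc m, so for f outside this range every indicator is 0.
∑-Sn-sym m f S d G | no ¬range = ∑-cong (Sn (suc m)) (λ π π∈ → ι-*-cong (id-first? S f π)
  (λ { (_ , refl) → contradiction (∈-from⁻ 1 (suc m) (F∈from (∈-Sn⁻ π∈))) ¬range }))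

-- Brings the joint count into the form of `∑-Sn-sym`; the factor `ι (des π <? suc d)` is 1 wherever
-- des π ≡ d.
countJoint-∑ : ∀ (X Y X₀ Y₀ : List ℕ → ℕ) → (∀ π → X π ≡ X₀ π + des π) → (∀ π → Y π ≡ Y₀ π + des π) →
  ∀ n d S f a b → countJoint X Y n d S f a b ≡
    ∑ (Sn n) (λ π → ι (id-first? S f π) * (ι (des π <? suc d) *
      ι ((des π ≟ d) ×-dec (X₀ π + des π ≟ a) ×-dec (Y₀ π + des π ≟ b))))
countJoint-∑ X Y X₀ Y₀ eX eY n d S f a b = trans (length-filter joint? (Sn n)) (∑-cong (Sn n) (λ π _ → trans
  (ι-cong (joint? π) (id-first? S f π ×-dec ((des π <? suc d) ×-dec rest? π))
    (λ (e , i , g , x , y) → (i , g) , s≤s (≤-reflexive e) , e , trans (sym (eX π)) x , trans (sym (eY π)) y)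
    (λ ((i , g) , _ , e , x , y) → e , i , g , trans (eX π) x , trans (eY π) y))
  (trans (b2n-∧ (does (id-first? S f π)) _)
    (cong (ι (id-first? S f π) *_) (b2n-∧ (does (des π <? suc d)) _)))))
  where
  joint? : Decidable (λ π → des π ≡ d × Id π ≡ S × F π ≡ f × X π ≡ a × Y π ≡ b)
  joint? π = (des π ≟ d) ×-dec ≡-dec _≟_ (Id π) S ×-dec (F π ≟ f) ×-dec (X π ≟ a) ×-dec (Y π ≟ b)
  rest? : Decidable (λ π → des π ≡ d × X₀ π + des π ≡ a × Y₀ π + des π ≡ b)
  rest? π = (des π ≟ d) ×-dec (X₀ π + des π ≟ a) ×-dec (Y₀ π + des π ≟ b)

theorem1p3 : (n : ℕ) → 1 Data.Nat.≤ n → (d f a b : ℕ) (S : List ℕ) →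
    countJoint MAJ STAT n d S f a b ≡ countJoint STAT MAJ n d S f a b
theorem1p3 (suc m) _ d f a b S = trans
  (countJoint-∑ MAJ STAT (majFrom 0) stat₀ MAJ≡ STAT≡ (suc m) d S f a b)
  (trans
    -- G tests the reduced statistics after adding e = des π back, so exchanging x and y exchanges
    -- MAJ and STAT.
    (∑-Sn-sym m f S (suc d) (λ e x y → ι ((e ≟ d) ×-dec (x + e ≟ a) ×-dec (y + e ≟ b))))
    (sym (countJoint-∑ STAT MAJ stat₀ (majFrom 0) STAT≡ MAJ≡ (suc m) d S f a b)))
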